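{- Let $n\ge0$ and let $\sigma,\tau\in\mathrm{Typ}(n)$ be types of $n$. (1) The coefficient of $E_\tau$ in the expansion of $H_\sigma$ in the basis $\{E_\rho:\rho\in\mathrm{Typ}(n)\}$ is $(-1)^{\ell(\tau)}\,|\mathcal{PT}^{\mathrm{simp}}(\sigma,\tau)|$. (2) The coefficient of $H_\tau$ in the expansion of $E_\sigma$ in the basis $\{H_\rho:\rho\in\mathrm{Typ}(n)\}$ is $(-1)^{\ell(\tau)}\,|\mathcal{PT}^{\mathrm{simp}}(\sigma,\tau)|$.
   Context: A type of $n$ is a sequence $\tau=(\tau|^1,\tau|^2,\dots)$ of (possibly empty) integer partitions with $\sum_{i\ge1} i\,|\tau|^i|=n$, where $|\tau|^i|$ is the size of the partition $\tau|^i$; $\mathrm{Typ}(n)$ is the set of types of $n$. Its length is $\ell(\tau)=\sum_i\ell(\tau|^i)$, the total number of parts. Each part $d$ of $\tau|^r$ gives a block $d^r$ of $\tau$ (degree $d$, multiplicity $r$; not exponentiation). Let $x_{i,j}$ ($i,j\ge 1$) be indeterminates with $\deg x_{i,j}=i$; all series have rational coefficients. A monomial is square-free if every exponent is at most $1$. $H_d$ is the sum of all monomials of degree $d$; $E_d$ is the sum over square-free monomials $f$ of degree $d$ of $(-1)^{m(f)}f$, where $m(f)$ is the number of indeterminates in $f$. For $F\in\{H,E\}$, $F_{d^r}$ is obtained from $F_d$ by replacing each $x_{i,j}$ by $x_{i,j}^r$, and $F_\tau=\prod F_{d^r}$ over all blocks $d^r$ of $\tau$ (counted with repetition; empty product $=1$).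 It is known that $\{H_\tau\}_{\tau\in\mathrm{Typ}(n)}$ and $\{E_\tau\}_{\tau\in\mathrm{Typ}(n)}$ are $\mathbb{Q}$-bases of the space $\mathrm{PSym}(n)$ of polysymmetric functions of degree $n$ (power series homogeneous of degree $n$ that are symmetric separately in each variable set $\{x_{i,j}\}_{j\ge1}$). The diagram of a partition $\lambda$ has left-justified rows of $\lambda_1,\lambda_2,\dots$ cells. A brick is a nonempty set of consecutive cells in one row; its length is its number of cells. A brick tabloid of shape $\lambda$ and content $\mu$ ($\lambda,\mu$ partitions) is a decomposition of the diagram of $\lambda$ into disjoint bricks whose multiset of lengths is the multiset of parts of $\mu$. A simple polybrick tabloid of shape $\sigma$ and content $\tau$ is a sequence $(T_i)_{i\ge1}$ where $T_i$ is a brick tabloid of shape $\sigma|^i$ and content $\tau|^i$ for each $i$. $\mathcal{PT}^{\mathrm{simp}}(\sigma,\tau)$ is the set of these. -}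

module Defs where

import Algebra.Definitions.RawSemiring
open import Data.Bool.Base using (if_then_else_)
open import Data.Fin.Base using (Fin; toℕ)
open import Data.Integer.Base using (+_)
open import Data.Irrelevant using ([_])
open import Data.List.Base as List
  using (List; []; _∷_; _++_; allFin; cartesianProductWith; concat; concatMap;
         deduplicate; filter; length; map; upTo)
open import Data.List.Membership.Propositional using (_∈_)
open import Data.List.Membership.Propositional.Properties
  using (∈-++⁺ˡ; ∈-++⁺ʳ; ∈-cartesianProductWith⁺; ∈-concatMap⁺; ∈-deduplicate⁺;
         ∈-map⁺; ∈-upTo⁺; ∈-∃++; ∈-allFin)
open import Data.List.Properties using (≡-dec)
open import Data.List.Relation.Binary.Permutation.Propositional
  using (_↭_; ↭-refl; ↭-trans; ↭-sym; prep)
open import Data.List.Relation.Binary.Permutation.Propositional.Properties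
  using (drop-mid; ∈-resp-↭; shift; ¬x∷xs↭[])
open import Data.List.Relation.Unary.All as All using (All; []; _∷_; all?)
open import Data.List.Relation.Unary.Any as Any using (here; there; any?)
open import Data.List.Relation.Unary.Linked using (Linked; linked?)
open import Data.List.Relation.Unary.Unique.Propositional using (Unique)
open import Data.List.Relation.Unary.Unique.DecPropositional.Properties using (deduplicate-!)
open import Data.Nat.Base using (ℕ; zero; suc; _≤_; _<_; _≥_; _∸_; s≤s; NonZero)
import Data.Nat.Base as ℕ using (_+_; _*_)
open import Data.Nat.Divisibility using (_∣_; _∣?_)
import Data.Nat.DivMod as ℕ using (_/_)
open import Data.Nat.ListAction using (sum)
import Data.Nat.Properties as ℕ
open import Data.Product.Base using (_×_; _,_; proj₁)
open import Data.Rational.Base using (ℚ; 0ℚ; 1ℚ; _+_; _*_; -_; _/_)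
import Data.Rational.Base as ℚ using (+-*-rawSemiring)
open import Data.Refinement using (Refinement-syntax; _,_; value)
import Data.Refinement as Refinement using (_≟_)
open import Data.Vec.Base as Vec using (Vec; []; _∷_; lookup)
import Data.Vec.Properties as Vec using (≡-dec)
open import Data.Vec.Relation.Binary.Pointwise.Inductive using (Pointwise; []; _∷_)
open import Function.Base using (_∘_)
open import Function.Bundles using (_↔_; Inverse)
open import Relation.Binary.Definitions using (DecidableEquality)
open import Relation.Binary.PropositionalEquality using (_≡_; _≢_; refl; subst)
open import Relation.Nullary.Decidable using (Dec; yes; no; map′; recompute; ⌊_⌋; _×-dec_)
open import Relation.Nullary.Negation using (contradiction; contradiction-irr)
open import Relation.Unary using (Decidable)

open Algebra.Definitions.RawSemiring ℚ.+-*-rawSemiring public using (_^_)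

record Finite (A : Set) : Set where
  field
    _≟_      : DecidableEquality A
    elements : List A
    complete : ∀ x → x ∈ elements
    unique   : Unique elements

  card : ℕ
  card = length elements

open Finite using (elements; complete; card)

covering : {A : Set} → DecidableEquality A → (xs : List A) → (∀ x → x ∈ xs) → Finite A
covering _≟_ xs ∈xs = record
  { _≟_      = _≟_
  ; elements = deduplicate _≟_ xs
  ; complete = λ x → ∈-deduplicate⁺ _≟_ (∈xs x)
  ; unique   = deduplicate-! _≟_ xs
  }

module _ {A : Set} {P : A → Set} (P? : Decidable P) where

  refineOne : A → List [ x ∈ A ∣ P x ]
  refineOne x with P? x
  ... | yes p = (x , [ p ]) ∷ []
  ... | no  _ = []

  refineList : List A → List [ x ∈ A ∣ P x ]
  refineList = concatMap refineOne

  ∈-refineOne : ∀ x .(p : P x) → (x , [ p ]) ∈ refineOne x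
  ∈-refineOne x p with P? x
  ... | yes _ = here refl
  ... | no ¬p = contradiction-irr p ¬p

  ∈-refineList : ∀ {xs x} .(p : P x) → x ∈ xs → (x , [ p ]) ∈ refineList xs
  ∈-refineList {xs} {x} p x∈xs =
    ∈-concatMap⁺ refineOne {xs = xs} (Any.map (λ { refl → ∈-refineOne x p }) x∈xs)

  finite-refine : Finite A → Finite [ x ∈ A ∣ P x ]
  finite-refine fin = covering (Refinement._≟_ (Finite._≟_ fin)) (refineList (elements fin))
    λ { (x , [ p ]) → ∈-refineList p (complete fin x) }

_↭?_ : (xs ys : List ℕ) → Dec (xs ↭ ys)
[]       ↭? []       = yes ↭-refl
[]       ↭? (y ∷ ys) = no (¬x∷xs↭[] ∘ ↭-sym)
(x ∷ xs) ↭? ys with any? (x ℕ.≟_) ys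
... | no  x∉ys = no λ p → x∉ys (∈-resp-↭ p (here refl))
... | yes x∈ys with ∈-∃++ x∈ys
...   | as , bs , refl = map′
        (λ p → ↭-trans (prep x p) (↭-sym (shift x as bs)))
        (drop-mid [] as)
        (xs ↭? (as ++ bs))

Partition : Set
Partition = [ λs ∈ List ℕ ∣ All (0 <_) λs × Linked _≥_ λs ]

parts : Partition → List ℕ
parts = value

∣_∣ : Partition → ℕ
∣ lam ∣ = sum (parts lam)

-- Since Σ i |τ|ⁱ| = n forces τ|ⁱ = ∅ for all i > n, only the first n
-- entries of the sequence are recorded.  The entry τ|ⁱ is found at
-- position i - 1.

weight : ∀ {n} → Vec Partition n → ℕ
weight {n} v = sum (map (λ i → suc (toℕ i) ℕ.* ∣ lookup v i ∣) (allFin n))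

Typ : ℕ → Set
Typ n = [ v ∈ Vec Partition n ∣ weight v ≡ n ]

ℓ : ∀ {n} → Typ n → ℕ
ℓ {n} τ = sum (map (λ i → length (parts (lookup (value τ) i))) (allFin n))

-- The pair (d , i) stands for the block dʳ with r = i + 1.
blocks : ∀ {n} → Typ n → List (ℕ × Fin n)
blocks {n} τ = concatMap (λ i → map (_, i) (parts (lookup (value τ) i))) (allFin n)

private
  _≟ₚ_ : DecidableEquality Partition
  _≟ₚ_ = Refinement._≟_ (≡-dec ℕ._≟_)

  lists : ℕ → ℕ → List (List ℕ)
  lists b zero    = [] ∷ []
  lists b (suc k) = [] ∷ cartesianProductWith _∷_ (upTo (suc b)) (lists b k)

  ∈-lists : ∀ b k {xs} → All (0 <_) xs → sum xs ≤ b → sum xs ≤ k → xs ∈ lists b k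
  ∈-lists b zero    []          _   _   = here refl
  ∈-lists b (suc k) []          _   _   = here refl
  ∈-lists b zero    (s≤s _ ∷ _) _   ()
  ∈-lists b (suc k) (_∷_ {x = suc x} {xs} p ps) ≤b (s≤s ≤k) =
    there (∈-cartesianProductWith⁺ _∷_
      (∈-upTo⁺ (s≤s (ℕ.≤-trans (ℕ.m≤m+n (suc x) (sum xs)) ≤b)))
      (∈-lists b k ps (ℕ.≤-trans (ℕ.m≤n+m (sum xs) (suc x)) ≤b)
                      (ℕ.≤-trans (ℕ.m≤n+m (sum xs) x) ≤k)))

  partition? : Decidable (λ λs → All (0 <_) λs × Linked _≥_ λs)
  partition? λs = all? (0 ℕ.<?_) λs ×-dec linked? ℕ._≥?_ λs

  partitions : ℕ → List Partition
  partitions b = refineList partition? (lists b b)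

  ∈-partitions : ∀ b lam → ∣ lam ∣ ≤ b → lam ∈ partitions b
  ∈-partitions b (λs , [ p ]) ≤b = ∈-refineList partition? p
    (∈-lists b b (proj₁ (recompute (partition? λs) p)) ≤b ≤b)

  vecs : {A : Set} → List A → ∀ n → List (Vec A n)
  vecs xs zero    = [] ∷ []
  vecs xs (suc n) = cartesianProductWith _∷_ xs (vecs xs n)

  ∈-vecs : {A : Set} (xs : List A) → ∀ {n} (v : Vec A n) →
           (∀ i → lookup v i ∈ xs) → v ∈ vecs xs n
  ∈-vecs xs []      _ = here refl
  ∈-vecs xs (x ∷ v) h =
    ∈-cartesianProductWith⁺ _∷_ (h Fin.zero) (∈-vecs xs v (h ∘ Fin.suc))

  term≤sum : {A : Set} (f : A → ℕ) → ∀ {x xs} → x ∈ xs → f x ≤ sum (map f xs)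
  term≤sum f (here refl)                = ℕ.m≤m+n _ _
  term≤sum f {xs = y ∷ _} (there x∈xs) = ℕ.≤-trans (term≤sum f x∈xs) (ℕ.m≤n+m _ (f y))

  size≤weight : ∀ {n} (v : Vec Partition n) i → ∣ lookup v i ∣ ≤ weight v
  size≤weight v i = ℕ.≤-trans (ℕ.m≤m+n _ _)
    (term≤sum (λ i → suc (toℕ i) ℕ.* ∣ lookup v i ∣) (∈-allFin i))

  weight? : ∀ n → Decidable (λ (v : Vec Partition n) → weight v ≡ n)
  weight? n v = weight v ℕ.≟ n

finiteTyp : ∀ n → Finite (Typ n)
finiteTyp n = covering (Refinement._≟_ (Vec.≡-dec _≟ₚ_))
  (refineList (weight? n) (vecs (partitions n) n))
  λ { (v , [ p ]) → ∈-refineList (weight? n) p (∈-vecs (partitions n) v λ i →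
        ∈-partitions n (lookup v i)
          (subst (∣ lookup v i ∣ ≤_) (recompute (weight? n v) p) (size≤weight v i))) }

-- A decomposition into bricks of the cells s, s + 1, …, e - 1 of a row,
-- listed from left to right: brick _ : s < m is the brick occupying the
-- cells s, …, m - 1.

data Bricks : ℕ → ℕ → Set where
  []    : ∀ {e} → Bricks e e
  brick : ∀ {s m e} → .(s < m) → Bricks m e → Bricks s e

lengths : ∀ {s e} → Bricks s e → List ℕ
lengths []                    = []
lengths (brick {s} {m} _ bs) = m ∸ s ∷ lengths bs

rowLengths : ∀ {rows} → All (Bricks 0) rows → List ℕ
rowLengths = concat ∘ All.reduce lengths

BrickTabloid : Partition → Partition → Set
BrickTabloid lam mu = [ T ∈ All (Bricks 0) (parts lam) ∣ rowLengths T ↭ parts mu ]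

PTsimp : ∀ {n} → Typ n → Typ n → Set
PTsimp σ τ = Pointwise BrickTabloid (value σ) (value τ)

private
  bricks-≤ : ∀ {s e} → Bricks s e → s ≤ e
  bricks-≤ []            = ℕ.≤-refl
  bricks-≤ (brick s<m b) =
    ℕ.≤-trans (ℕ.<⇒≤ (recompute (_ ℕ.<? _) s<m)) (bricks-≤ b)

  empty : ∀ s e → List (Bricks s e)
  empty s e with s ℕ.≟ e
  ... | yes refl = [] ∷ []
  ... | no  _    = []

  ∈-empty : ∀ e → [] ∈ empty e e
  ∈-empty e with e ℕ.≟ e
  ... | yes refl = here refl
  ... | no  e≢e  = contradiction refl e≢e

  first : ∀ {e} s m → List (Bricks m e) → List (Bricks s e)
  first s m bs with s ℕ.<? m
  ... | yes s<m = map (brick s<m) bs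
  ... | no  _   = []

  ∈-first : ∀ {s m e} .(s<m : s < m) {b : Bricks m e} {bs} → b ∈ bs → brick s<m b ∈ first s m bs
  ∈-first {s} {m} s<m b∈bs with s ℕ.<? m
  ... | yes _   = ∈-map⁺ (brick s<m) b∈bs
  ... | no  s≮m = contradiction-irr s<m s≮m

  allBricks : ℕ → ∀ s e → List (Bricks s e)
  allBricks zero    s e = empty s e
  allBricks (suc k) s e =
    empty s e ++ concatMap (λ m → first s m (allBricks k m e)) (upTo (suc e))

  ∈-allBricks : ∀ k {s e} → e ≤ s ℕ.+ k → (b : Bricks s e) → b ∈ allBricks k s e
  ∈-allBricks zero    _ [] = ∈-empty _
  ∈-allBricks (suc k) _ [] = ∈-++⁺ˡ (∈-empty _)
  ∈-allBricks zero {s} e≤s+0 (brick s<m b) =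
    contradiction (ℕ.≤-trans (bricks-≤ b) (subst (_ ≤_) (ℕ.+-identityʳ s) e≤s+0))
                  (ℕ.<⇒≱ (recompute (_ ℕ.<? _) s<m))
  ∈-allBricks (suc k) {s} {e} e≤s+k (brick {m = m} s<m b) =
    ∈-++⁺ʳ (empty s e) (∈-concatMap⁺ (λ m → first s m (allBricks k m e))
      (Any.map (λ { refl → ∈-first s<m (∈-allBricks k e≤m+k b) })
               (∈-upTo⁺ (s≤s (bricks-≤ b)))))
    where
    e≤m+k : e ≤ m ℕ.+ k
    e≤m+k = ℕ.≤-trans (subst (e ≤_) (ℕ.+-suc s k) e≤s+k)
                      (ℕ.+-monoˡ-≤ k (recompute (s ℕ.<? m) s<m))

  _≟ᵇ_ : ∀ {s e} → DecidableEquality (Bricks s e)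
  [] ≟ᵇ []        = yes refl
  [] ≟ᵇ brick _ _ = no λ ()
  brick _ _ ≟ᵇ [] = no λ ()
  brick {m = m} _ b ≟ᵇ brick {m = m′} _ b′ with m ℕ.≟ m′
  ... | no  m≢m′ = no λ { refl → m≢m′ refl }
  ... | yes refl = map′ (λ { refl → refl }) (λ { refl → refl }) (b ≟ᵇ b′)

  finiteBricks : ∀ e → Finite (Bricks 0 e)
  finiteBricks e = covering _≟ᵇ_ (allBricks e 0 e) (∈-allBricks e ℕ.≤-refl)

  finiteAll : {P : ℕ → Set} → (∀ x → Finite (P x)) → ∀ xs → Finite (All P xs)
  finiteAll fin []       = covering (λ { [] [] → yes refl }) ([] ∷ []) λ { [] → here refl }
  finiteAll fin (x ∷ xs) = covering
    (λ { (p ∷ ps) (q ∷ qs) → map′ (λ { (refl , refl) → refl }) (λ { refl → refl , refl })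
           (Finite._≟_ (fin x) p q ×-dec Finite._≟_ (finiteAll fin xs) ps qs) })
    (cartesianProductWith _∷_ (elements (fin x)) (elements (finiteAll fin xs)))
    λ { (p ∷ ps) → ∈-cartesianProductWith⁺ _∷_ (complete (fin x) p)
                                              (complete (finiteAll fin xs) ps) }

  finitePointwise : {A : Set} {R : A → A → Set} → (∀ x y → Finite (R x y)) →
                    ∀ {n} (u v : Vec A n) → Finite (Pointwise R u v)
  finitePointwise fin []      []      =
    covering (λ { [] [] → yes refl }) ([] ∷ []) λ { [] → here refl }
  finitePointwise fin (x ∷ u) (y ∷ v) = covering
    (λ { (p ∷ ps) (q ∷ qs) → map′ (λ { (refl , refl) → refl }) (λ { refl → refl , refl })
           (Finite._≟_ (fin x y) p q ×-dec Finite._≟_ (finitePointwise fin u v) ps qs) })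
    (cartesianProductWith _∷_ (elements (fin x y)) (elements (finitePointwise fin u v)))
    λ { (p ∷ ps) → ∈-cartesianProductWith⁺ _∷_ (complete (fin x y) p)
                                              (complete (finitePointwise fin u v) ps) }

finiteBrickTabloid : ∀ lam mu → Finite (BrickTabloid lam mu)
finiteBrickTabloid lam mu =
  finite-refine (λ T → rowLengths T ↭? parts mu) (finiteAll finiteBricks (parts lam))

finitePTsimp : ∀ {n} (σ τ : Typ n) → Finite (PTsimp σ τ)
finitePTsimp σ τ = finitePointwise finiteBrickTabloid (value σ) (value τ)

∣PTsimp∣ : ∀ {n} → Typ n → Typ n → ℕ
∣PTsimp∣ σ τ = card (finitePTsimp σ τ)

-- A monomial is given by its table of exponents: row i - 1 lists the
-- exponents of x_{i,1}, x_{i,2}, …, and the exponents beyond the end of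
-- a row, or beyond the last row, are 0.  Hence tables differing by
-- trailing zeros represent the same monomial.

Monomial : Set
Monomial = List (List ℕ)

at : {A : Set} → A → List A → ℕ → A
at d []       _       = d
at d (x ∷ _)  zero    = x
at d (_ ∷ xs) (suc k) = at d xs k

-- The exponent of x_{i+1,j+1}.
exponent : Monomial → ℕ → ℕ → ℕ
exponent m i j = at 0 (at [] m i) j

degreeFrom : ℕ → Monomial → ℕ
degreeFrom i []        = 0
degreeFrom i (row ∷ m) = i ℕ.* sum row ℕ.+ degreeFrom (suc i) m

degree : Monomial → ℕ
degree = degreeFrom 1

-- A power series is given by its coefficients.  A function on tables of
-- exponents is a power series only if it does not depend on trailing
-- zeros; this is part of PSym below (take the identity permutation in
-- symmetric).

Series : Set
Series = Monomial → ℚ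

infix 4 _≈_
_≈_ : Series → Series → Set
F ≈ G = ∀ m → F m ≡ G m

∑ : {A : Set} → List A → (A → ℚ) → ℚ
∑ xs f = List.foldr (λ x q → f x + q) 0ℚ xs

-- All pairs (a , b) with a b = m, written with the same shape as m.

splitWith : {A : Set} → (A → List (A × A)) → List A → List (List A × List A)
splitWith f []       = ([] , []) ∷ []
splitWith f (x ∷ xs) = cartesianProductWith
  (λ { (a , b) (as , bs) → (a ∷ as) , (b ∷ bs) }) (f x) (splitWith f xs)

factorisations : Monomial → List (Monomial × Monomial)
factorisations = splitWith (splitWith λ e → map (λ k → k , e ∸ k) (upTo (suc e)))

infixl 7 _∙_
_∙_ : Series → Series → Series
(F ∙ G) m = ∑ (factorisations m) λ { (a , b) → F a * G b }

𝟙 : Series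
𝟙 m = if ⌊ all? (all? (ℕ._≟ 0)) m ⌋ then 1ℚ else 0ℚ

-- Replace each x_{i,j} by x_{i,j}ʳ.
substPower : (r : ℕ) .{{_ : NonZero r}} → Series → Series
substPower r F m =
  if ⌊ all? (all? (r ∣?_)) m ⌋ then F (map (map (ℕ._/ r)) m) else 0ℚ

SquareFree : Monomial → Set
SquareFree = All (All (_≤ 1))

squareFree? : Decidable SquareFree
squareFree? = all? (all? (ℕ._≤? 1))

indeterminates : Monomial → ℕ
indeterminates m = length (filter (0 ℕ.<?_) (concat m))

Hdeg : ℕ → Series
Hdeg d m = if ⌊ degree m ℕ.≟ d ⌋ then 1ℚ else 0ℚ

Edeg : ℕ → Series
Edeg d m = if ⌊ squareFree? m ×-dec degree m ℕ.≟ d ⌋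
           then (- 1ℚ) ^ indeterminates m else 0ℚ

blockProduct : (ℕ → Series) → ∀ {n} → Typ n → Series
blockProduct F τ =
  List.foldr _∙_ 𝟙 (map (λ { (d , i) → substPower (suc (toℕ i)) (F d) }) (blocks τ))

H : ∀ {n} → Typ n → Series
H = blockProduct Hdeg

E : ∀ {n} → Typ n → Series
E = blockProduct Edeg

record PSym (n : ℕ) (F : Series) : Set where
  field
    homogeneous : ∀ m → degree m ≢ n → F m ≡ 0ℚ
    symmetric   : ∀ i (π : ℕ ↔ ℕ) m m′ →
                  (∀ j → exponent m′ i (Inverse.to π j) ≡ exponent m i j) →
                  (∀ k → k ≢ i → ∀ j → exponent m′ k j ≡ exponent m k j) →
                  F m′ ≡ F m

linearCombination : ∀ {n} → (Typ n → ℚ) → (Typ n → Series) → Series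
linearCombination {n} c B m = ∑ (elements (finiteTyp n)) λ ρ → c ρ * B ρ m

record IsBasis (n : ℕ) (B : Typ n → Series) : Set where
  field
    member      : ∀ ρ → PSym n (B ρ)
    independent : ∀ c → linearCombination c B ≈ (λ _ → 0ℚ) → ∀ ρ → c ρ ≡ 0ℚ
    coefficient : ∀ {F} → PSym n F → Typ n → ℚ
    expansion   : ∀ {F} (F∈ : PSym n F) → F ≈ linearCombination (coefficient F∈) B

signedCount : ∀ {n} → Typ n → Typ n → ℚ
signedCount σ τ = (- 1ℚ) ^ ℓ τ * (+ ∣PTsimp∣ σ τ / 1)

{-# OPTIONS --safe #-}

-- Since Σₖ Eₖ Hₙ₋ₖ = 0 for n > 0, we have Hₙ = Σₖ (- Eₖ) Hₙ₋ₖ over k ≥ 1: the factor - Eₖ records a first brick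
-- of length k, so Hₙ is the sum over all brickings of a row of n cells of the product of the - E_l, l running over
-- the brick lengths.  The substitution x ↦ xʳ is a ring homomorphism, so the same holds for the blocks of
-- multiplicity r.  Multiplying over the rows of σ turns H_σ into a sum over all brickings of all rows, and grouping
-- these by content gives the coefficients.  The roles of H and E are symmetric.
--
-- Series are multiplied by summing over splittings of exponent tables.  The laws of the product hold for a single
-- exponent and are inherited by lists (splitWith), hence by rows and then by tables.

module Submission where

open import Defs
open import Algebra.Bundles using (CommutativeMonoid; CommutativeSemiring; CommutativeRing)
import Algebra.Properties.CommutativeSemigroup as CommutativeSemigroupProperties
import Algebra.Properties.Group as GroupProperties
import Algebra.Properties.Ring as RingProperties
import Algebra.Properties.Semiring.Exp as SemiringExp
open import Algebra.Structures using (IsMonoid; IsCommutativeSemiring)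
open import Algebra.Structures.Biased using (isCommutativeSemiringˡ)
open import Data.Bool.Base using (if_then_else_)
open import Data.Fin.Base as Fin using (Fin; toℕ)
import Data.Integer.Base as ℤ using (+_; _+_; _*_)
import Data.Integer.Properties as ℤ
open import Data.Irrelevant using ([_])
open import Data.List.Base
  using (List; []; _∷_; _++_; allFin; applyUpTo; cartesianProductWith; concat; concatMap; filter; foldr; length;
         map; upTo)
open import Data.List.Membership.Propositional using (_∈_; find)
open import Data.List.Membership.Propositional.Properties
  using (∈-++⁺ˡ; ∈-++⁺ʳ; ∈-cartesianProductWith⁺; ∈-concatMap⁺; ∈-concatMap⁻; ∈-map⁺; ∈-map⁻; ∈-upTo⁺; ∈-upTo⁻)
open import Data.List.Membership.Propositional.Properties.WithK using (unique∧set⇒bag)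
open import Data.List.Properties
  using (filter-++; length-++; length-map; map-applyUpTo; map-cong; map-tabulate; map-∘)
open import Data.List.Relation.Binary.BagAndSetEquality using (∼bag⇒↭)
open import Data.List.Relation.Binary.Permutation.Propositional as ↭ using (_↭_; ↭⇒↭ₛ′; ↭-trans; ↭-sym)
open import Data.List.Relation.Binary.Permutation.Propositional.Properties using (All-resp-↭)
open import Data.List.Relation.Binary.Pointwise using (Pointwise-≡⇒≡)
open import Data.List.Relation.Unary.All as All using (All; []; _∷_; all?)
import Data.List.Relation.Unary.All.Properties as All
open import Data.List.Relation.Unary.AllPairs using ([]; _∷_)
open import Data.List.Relation.Unary.Any as Any using (here; there)
open import Data.List.Relation.Unary.Linked using (linked?)
open import Data.List.Relation.Unary.Sorted.TotalOrder.Properties using (↗↭↗⇒≋)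
open import Data.List.Relation.Unary.Unique.Propositional using (Unique)
import Data.List.Relation.Unary.Unique.Propositional.Properties as Unique
import Data.List.Sort as Sort
open import Data.Nat.Base using (ℕ; zero; suc; _∸_; _≤_; _<_; z≤n; s≤s; NonZero)
import Data.Nat.Base as ℕ using (_+_; _*_)
open import Data.Nat.Divisibility using (_∣?_; _∣0; ∣⇒≤; ∣m+n∣m⇒∣n; ∣m∣n⇒∣m+n; ∣-refl)
import Data.Nat.DivMod as ℕ
open import Data.Nat.Induction using (<-rec)
open import Data.Nat.ListAction using (sum)
open import Data.Nat.ListAction.Properties using (sum-++; sum-↭)
import Data.Nat.Properties as ℕ
open import Data.Product.Base using (_×_; _,_; proj₂; uncurry; ∃)
open import Data.Rational.Base using (ℚ; 0ℚ; 1ℚ; _+_; _*_; -_; _/_; toℚᵘ)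
import Data.Rational.Properties as ℚ
import Data.Rational.Unnormalised.Base as ℚᵘ
import Data.Rational.Unnormalised.Properties as ℚᵘ
open import Data.Refinement using (_,_; value; value-injective)
open import Data.Vec.Base as Vec using (Vec; []; _∷_; lookup)
import Data.Vec.Properties as Vec
open import Data.Vec.Relation.Binary.Pointwise.Inductive using (Pointwise; []; _∷_)
import Data.Vec.Relation.Unary.All as VecAll
open VecAll using ([]; _∷_)
open import Function.Base using (_∘_; flip)
open import Function.Bundles using (mk⇔)
open import Level using (0ℓ)
open import Relation.Binary.Bundles using (TotalOrder)
open import Relation.Binary.Properties.DecTotalOrder ℕ.≤-decTotalOrder using (≥-decTotalOrder; ≥-totalOrder)
open import Relation.Binary.PropositionalEquality
  using (_≡_; refl; sym; trans; cong; cong₂; subst; module ≡-Reasoning)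
import Relation.Binary.Reasoning.Setoid as SetoidReasoning
open import Relation.Binary.Structures using (IsEquivalence)
open import Relation.Nullary.Decidable using (Dec; yes; no; ⌊_⌋; recompute; _×-dec_)
open import Relation.Nullary.Negation using (¬_; contradiction)
open import Relation.Unary using (Decidable)
open Finite using (elements; complete; unique)
open Sort ≥-decTotalOrder using (sort; sort-↭; sort-↗)

-- Finite sums and products

-- The relation between E and H comes from a single variable: `sign` lists the coefficients of 1 -
-- x, and the constant 1 those of 1/(1 - x). Their product is checked exponent by exponent; the
-- total degree is the same for every splitting of a monomial and comes out as a common factor.
-- Because E carries the sign (-1)^m(f), the relation itself has no alternating signs, and every
-- brick contributes exactly one minus sign, whichever family is expanded. The obstacle in the
-- counting is that `elements` of a `Finite` type is a deduplicated search list, with no recursion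
-- that mirrors multiplying out. Brickings are therefore listed a second time, by recursion on the
-- first brick, and the two enumerations are compared once: duplicate-free lists with the same
-- members are permutations of each other.

module BigOp {c ℓ} (M : CommutativeMonoid c ℓ) where
  open CommutativeMonoid M
    renaming (Carrier to C; refl to ≈-refl; sym to ≈-sym; trans to ≈-trans; _∙_ to _⊕_; _≈_ to _≋_)
  open SetoidReasoning setoid
  open CommutativeSemigroupProperties commutativeSemigroup using (interchange)

  private variable
    A B : Set

  -- The same fold as `∑`, so over the rationals the two agree definitionally; with the
  -- multiplicative monoid it gives the products.
  big : List A → (A → C) → C
  big xs f = foldr (λ x y → f x ⊕ y) ε xs

  big-cong-∈ : ∀ (xs : List A) {f g : A → C} → (∀ {x} → x ∈ xs → f x ≋ g x) → big xs f ≋ big xs g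
  big-cong-∈ []       f≈g = ≈-refl
  big-cong-∈ (x ∷ xs) f≈g = ∙-cong (f≈g (here refl)) (big-cong-∈ xs (f≈g ∘ there))

  big-cong : ∀ (xs : List A) {f g : A → C} → (∀ x → f x ≋ g x) → big xs f ≋ big xs g
  big-cong xs f≈g = big-cong-∈ xs (λ {x} _ → f≈g x)

  big-map : ∀ (h : A → B) xs (f : B → C) → big (map h xs) f ≡ big xs (f ∘ h)
  big-map h []       f = refl
  big-map h (x ∷ xs) f = cong (f (h x) ⊕_) (big-map h xs f)

  big-++ : ∀ (xs ys : List A) f → big (xs ++ ys) f ≋ big xs f ⊕ big ys f
  big-++ []       ys f = ≈-sym (identityˡ _)
  big-++ (x ∷ xs) ys f = ≈-trans (∙-congˡ (big-++ xs ys f)) (≈-sym (assoc _ _ _))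

  big-concatMap : ∀ (h : A → List B) xs f → big (concatMap h xs) f ≋ big xs (λ x → big (h x) f)
  big-concatMap h []       f = ≈-refl
  big-concatMap h (x ∷ xs) f = ≈-trans (big-++ (h x) (concatMap h xs) f) (∙-congˡ (big-concatMap h xs f))

  big-ε : ∀ (xs : List A) → big xs (λ _ → ε) ≋ ε
  big-ε []       = ≈-refl
  big-ε (x ∷ xs) = ≈-trans (identityˡ _) (big-ε xs)

  big-∙ : ∀ (xs : List A) f g → big xs (λ x → f x ⊕ g x) ≋ big xs f ⊕ big xs g
  big-∙ []       f g = ≈-sym (identityˡ ε)
  big-∙ (x ∷ xs) f g = ≈-trans (∙-congˡ (big-∙ xs f g)) (interchange _ _ _ _)

  big-swap : ∀ (xs : List A) (ys : List B) (f : A → B → C) →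
             big xs (λ x → big ys (f x)) ≋ big ys (λ y → big xs (λ x → f x y))
  big-swap []       ys f = ≈-sym (big-ε ys)
  big-swap (x ∷ xs) ys f = ≈-trans (∙-congˡ (big-swap xs ys f)) (≈-sym (big-∙ ys _ _))

  big-↭ : ∀ {xs ys : List A} (f : A → C) → xs ↭ ys → big xs f ≋ big ys f
  big-↭ f ↭.refl         = ≈-refl
  big-↭ f (↭.prep x p)   = ∙-congˡ (big-↭ f p)
  big-↭ f (↭.swap x y p) = begin
    f x ⊕ (f y ⊕ _) ≈⟨ assoc _ _ _ ⟨
    (f x ⊕ f y) ⊕ _ ≈⟨ ∙-cong (comm _ _) (big-↭ f p) ⟩
    (f y ⊕ f x) ⊕ _ ≈⟨ assoc _ _ _ ⟩
    f y ⊕ (f x ⊕ _) ∎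
  big-↭ f (↭.trans p q)  = ≈-trans (big-↭ f p) (big-↭ f q)

  big-allFin : ∀ {n} (f : Fin (suc n) → C) →
               big (allFin (suc n)) f ≡ f Fin.zero ⊕ big (allFin n) (f ∘ Fin.suc)
  big-allFin {n} f = cong (f Fin.zero ⊕_)
    (trans (cong (λ is → big is f) (sym (map-tabulate (λ i → i) Fin.suc))) (big-map Fin.suc (allFin n) f))

module Sums {c ℓ} (R : CommutativeSemiring c ℓ) where
  open CommutativeSemiring R
    renaming (Carrier to C; refl to ≈-refl; sym to ≈-sym; trans to ≈-trans; _≈_ to _≋_; _+_ to _⊕_; _*_ to _⊗_)

  open BigOp +-commutativeMonoid public
    using ()
    renaming (big to ⨁; big-cong-∈ to ⨁-cong-∈; big-cong to ⨁-cong; big-map to ⨁-map; big-++ to ⨁-++;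
              big-concatMap to ⨁-concatMap; big-ε to ⨁-0; big-∙ to ⨁-+; big-swap to ⨁-swap; big-↭ to ⨁-↭)
  open BigOp *-commutativeMonoid public
    using ()
    renaming (big to ⨂; big-cong to ⨂-cong; big-map to ⨂-map; big-++ to ⨂-++; big-concatMap to ⨂-concatMap;
              big-↭ to ⨂-↭; big-allFin to ⨂-allFin)

  private variable
    A B D : Set

  ⨁-*ˡ : ∀ (xs : List A) a f → ⨁ xs (λ x → a ⊗ f x) ≋ a ⊗ ⨁ xs f
  ⨁-*ˡ []       a f = ≈-sym (zeroʳ a)
  ⨁-*ˡ (x ∷ xs) a f = ≈-trans (+-congˡ (⨁-*ˡ xs a f)) (≈-sym (distribˡ _ _ _))

  ⨁-*ʳ : ∀ (xs : List A) a f → ⨁ xs (λ x → f x ⊗ a) ≋ ⨁ xs f ⊗ a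
  ⨁-*ʳ []       a f = ≈-sym (zeroˡ a)
  ⨁-*ʳ (x ∷ xs) a f = ≈-trans (+-congˡ (⨁-*ʳ xs a f)) (≈-sym (distribʳ _ _ _))

  ⨁-cartesianProductWith : ∀ (h : A → B → D) xs ys f →
    ⨁ (cartesianProductWith h xs ys) f ≋ ⨁ xs (λ x → ⨁ ys (λ y → f (h x y)))
  ⨁-cartesianProductWith h []       ys f = ≈-refl
  ⨁-cartesianProductWith h (x ∷ xs) ys f = ≈-trans (⨁-++ (map (h x) ys) _ f)
    (+-cong (reflexive (⨁-map (h x) ys f)) (⨁-cartesianProductWith h xs ys f))

  ⨁-product : ∀ (xs : List A) (ys : List B) f g →
    ⨁ xs f ⊗ ⨁ ys g ≋ ⨁ xs (λ x → ⨁ ys (λ y → f x ⊗ g y))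
  ⨁-product xs ys f g = ≈-trans (≈-sym (⨁-*ʳ xs _ f)) (⨁-cong xs λ x → ≈-sym (⨁-*ˡ ys (f x) g))

private variable
  A : Set

Splitting : Set → Set
Splitting A = A → List (A × A)

-- Serves twice: for the exponent of one variable, and for the degrees of the two factors in the
-- relation between `Hdeg` and `Edeg`.
splitℕ : Splitting ℕ
splitℕ e = map (λ k → k , e ∸ k) (upTo (suc e))

splitℕ-suc : ∀ e → splitℕ (suc e) ≡ (0 , suc e) ∷ map (λ (a , b) → suc a , b) (splitℕ e)
splitℕ-suc e = cong ((0 , suc e) ∷_) (begin
  map (λ k → k , suc e ∸ k) (applyUpTo suc (suc e))         ≡⟨ cong (map _) (map-applyUpTo (λ k → k) suc (suc e)) ⟨
  map (λ k → k , suc e ∸ k) (map suc (upTo (suc e)))        ≡⟨ map-∘ (upTo (suc e)) ⟨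
  map (λ k → suc k , e ∸ k) (upTo (suc e))                  ≡⟨ map-∘ (upTo (suc e)) ⟩
  map (λ (a , b) → suc a , b) (splitℕ e)                     ∎)
  where open ≡-Reasoning

-- Brickings

-- Different lists `f x` cannot overlap, because `label` recovers `g x`, hence `x`, from any member.
concatMap-unique : ∀ {A B C : Set} (f : A → List B) (label : B → C) (g : A → C) →
  (∀ {x y} → g x ≡ g y → x ≡ y) → (∀ x {y} → y ∈ f x → label y ≡ g x) → (∀ x → Unique (f x)) →
  ∀ {xs} → Unique xs → Unique (concatMap f xs)
concatMap-unique f label g g-inj lab f! {[]}     []         = []
concatMap-unique f label g g-inj lab f! {x ∷ xs} (x∉ ∷ xs!) =
  Unique.++⁺ (f! x) (concatMap-unique f label g g-inj lab f! xs!) disjoint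
  where
  disjoint : ∀ {y} → ¬ (y ∈ f x × y ∈ concatMap f xs)
  disjoint (y∈fx , y∈) with find (∈-concatMap⁻ f {xs = xs} y∈)
  ... | x′ , x′∈xs , y∈fx′ =
    All.lookup x∉ x′∈xs (g-inj (trans (sym (lab x y∈fx)) (lab x′ y∈fx′)))

bricks-≤ : ∀ {s e} → Bricks s e → s ≤ e
bricks-≤ []            = ℕ.≤-refl
bricks-≤ (brick s<m β) = ℕ.≤-trans (ℕ.<⇒≤ (recompute (_ ℕ.<? _) s<m)) (bricks-≤ β)

-- The decision is an argument so that lemmas can match on it directly.
noBricks : ∀ {s e} → Dec (s ≡ e) → List (Bricks s e)
noBricks (yes refl) = [] ∷ []
noBricks (no _)     = []

-- The first argument g is fuel: every decomposition is listed as soon as e ∸ s ≤ g.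
mutual
  bricks : ℕ → ∀ s e → List (Bricks s e)
  bricks zero    s e = noBricks (s ℕ.≟ e)
  bricks (suc g) s e = noBricks (s ℕ.≟ e) ++ concatMap (bricksFrom g s e) (upTo (e ∸ s))

  -- The first brick has length `k + 1`. Writing its end as `suc k + s` supplies `s < m` for free,
  -- and `k` below `e ∸ s` covers exactly the ends up to `e`.
  bricksFrom : ℕ → ∀ s e → ℕ → List (Bricks s e)
  bricksFrom g s e k = map (brick (s≤s (ℕ.m≤n+m s k))) (bricks g (suc k ℕ.+ s) e)

[]∈noBricks : ∀ {e} (d : Dec (e ≡ e)) → [] ∈ noBricks d
[]∈noBricks (yes refl) = here refl
[]∈noBricks (no e≢e)   = contradiction refl e≢e

∸-suc-≤ : ∀ {s e g} k → e ∸ s ≤ suc g → e ∸ (suc k ℕ.+ s) ≤ g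
∸-suc-≤ {s} {e} {g} k e∸s≤ = begin
  e ∸ (suc k ℕ.+ s)  ≡⟨ cong (e ∸_) (ℕ.+-comm (suc k) s) ⟩
  e ∸ (s ℕ.+ suc k)  ≡⟨ ℕ.∸-+-assoc e s (suc k) ⟨
  e ∸ s ∸ suc k      ≤⟨ ℕ.∸-monoˡ-≤ (suc k) e∸s≤ ⟩
  g ∸ k              ≤⟨ ℕ.m∸n≤m g k ⟩
  g                  ∎
  where open ℕ.≤-Reasoning

bricks-complete : ∀ g {s e} → e ∸ s ≤ g → (β : Bricks s e) → β ∈ bricks g s e
bricks-complete zero    _ [] = []∈noBricks (_ ℕ.≟ _)
bricks-complete (suc g) _ [] = ∈-++⁺ˡ ([]∈noBricks (_ ℕ.≟ _))
bricks-complete zero {s} {e} e∸s≤0 (brick s<m β) = contradiction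
  (ℕ.≤-trans (recompute (_ ℕ.<? _) s<m) (ℕ.≤-trans (bricks-≤ β) (ℕ.m∸n≡0⇒m≤n (ℕ.n≤0⇒n≡0 e∸s≤0))))
  (ℕ.<-irrefl refl)
bricks-complete (suc g) {s} {e} e∸s≤1+g (brick {m = m} s<m β) =
  ∈-++⁺ʳ (noBricks (s ℕ.≟ e)) (listed (m ∸ suc s)
    (sym (trans (sym (ℕ.+-suc (m ∸ suc s) s)) (ℕ.m∸n+n≡m (recompute (s ℕ.<? m) s<m)))) s<m β)
  where
  -- The end `m` is generalised so that `refl` can put it in the form used by `bricksFrom`;
  -- irrelevance of `s<m` then makes the two bricks equal.
  listed : ∀ {m} k → m ≡ suc k ℕ.+ s → .(s<m : s < m) (β : Bricks m e) →
           brick s<m β ∈ concatMap (bricksFrom g s e) (upTo (e ∸ s))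
  listed k refl s<m β = ∈-concatMap⁺ (bricksFrom g s e) (Any.map
    (λ { refl → ∈-map⁺ (brick s<m) (bricks-complete g (∸-suc-≤ {s} {e} k e∸s≤1+g) β) })
    (∈-upTo⁺ (ℕ.m+n≤o⇒m≤o∸n (suc k) (bricks-≤ β))))

bricks-unique : ∀ g s e → Unique (bricks g s e)
bricks-unique g s e = go g s
  where
  noBricks-unique : ∀ {s} (d : Dec (s ≡ e)) → Unique (noBricks d)
  noBricks-unique (yes refl) = [] ∷ []
  noBricks-unique (no _)     = []

  firstEnd : ∀ {s} → Bricks s e → ℕ
  -- The value 0 is never the end of a first brick, so it sets the empty decomposition apart from
  -- all others in `disjoint`.
  firstEnd []                = 0
  firstEnd (brick {m = m} _ _) = m

  firstEnd-from : ∀ g s k {β} → β ∈ bricksFrom g s e k → firstEnd β ≡ suc k ℕ.+ s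
  firstEnd-from g s k β∈ with ∈-map⁻ _ β∈
  ... | _ , _ , refl = refl

  firstEnd-none : ∀ {s} (d : Dec (s ≡ e)) {β} → β ∈ noBricks d → firstEnd β ≡ 0
  firstEnd-none (yes refl) (here refl) = refl

  go : ∀ g s → Unique (bricks g s e)
  go zero    s = noBricks-unique (s ℕ.≟ e)
  go (suc g) s = Unique.++⁺ (noBricks-unique (s ℕ.≟ e))
    (concatMap-unique (bricksFrom g s e) firstEnd (λ k → suc k ℕ.+ s)
      (λ {x} {y} eq → ℕ.suc-injective (ℕ.+-cancelʳ-≡ s (suc x) (suc y) eq))
      (firstEnd-from g s)
      (λ k → Unique.map⁺ (λ { refl → refl }) (go g (suc k ℕ.+ s)))
      (Unique.upTo⁺ (e ∸ s)))
    disjoint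
    where
    disjoint : ∀ {β} → ¬ (β ∈ noBricks (s ℕ.≟ e) × β ∈ concatMap (bricksFrom g s e) (upTo (e ∸ s)))
    disjoint (β∈ , β∈′) with find (∈-concatMap⁻ (bricksFrom g s e) {xs = upTo (e ∸ s)} β∈′)
    ... | k , _ , β∈k with trans (sym (firstEnd-none (s ℕ.≟ e) β∈)) (firstEnd-from g s k β∈k)
    ...   | ()

rowBricks : ∀ ds → List (All (Bricks 0) ds)
rowBricks []       = [] ∷ []
rowBricks (d ∷ ds) = cartesianProductWith _∷_ (bricks d 0 d) (rowBricks ds)

rowBricks-complete : ∀ {ds} (T : All (Bricks 0) ds) → T ∈ rowBricks ds
rowBricks-complete []      = here refl
rowBricks-complete (β ∷ T) =
  ∈-cartesianProductWith⁺ _∷_ (bricks-complete _ ℕ.≤-refl β) (rowBricks-complete T)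

rowBricks-unique : ∀ ds → Unique (rowBricks ds)
rowBricks-unique []       = [] ∷ []
rowBricks-unique (d ∷ ds) = Unique.cartesianProductWith⁺ _∷_ (λ { refl → refl , refl })
  (bricks-unique d 0 d) (rowBricks-unique ds)

-- A polybrick tabloid whose content is left open.
Filling : ∀ {k} → Vec Partition k → Set
Filling = VecAll.All (λ lam → All (Bricks 0) (parts lam))

fillings : ∀ {k} (v : Vec Partition k) → List (Filling v)
fillings []        = [] ∷ []
fillings (lam ∷ v) = cartesianProductWith _∷_ (rowBricks (parts lam)) (fillings v)

fillings-complete : ∀ {k} {v : Vec Partition k} (T : Filling v) → T ∈ fillings v
fillings-complete []      = here refl
fillings-complete (t ∷ T) = ∈-cartesianProductWith⁺ _∷_ (rowBricks-complete t) (fillings-complete T)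

fillings-unique : ∀ {k} (v : Vec Partition k) → Unique (fillings v)
fillings-unique []        = [] ∷ []
fillings-unique (lam ∷ v) = Unique.cartesianProductWith⁺ _∷_ (λ { refl → refl , refl })
  (rowBricks-unique (parts lam)) (fillings-unique v)

lengthsAt : ∀ {k} {v : Vec Partition k} → Filling v → Fin k → List ℕ
lengthsAt (t ∷ T) Fin.zero    = rowLengths t
lengthsAt (t ∷ T) (Fin.suc i) = lengthsAt T i

-- Expanding products over brickings in a commutative ring

module _ {c ℓ} (R : CommutativeRing c ℓ) where
  open CommutativeRing R
    renaming (Carrier to C; refl to ≈-refl; sym to ≈-sym; trans to ≈-trans; _≈_ to _≋_;
              _+_ to _⊕_; _*_ to _⊗_; -_ to ⊖_)
  open Sums commutativeSemiring
  open SetoidReasoning setoid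

  -- The summation index k stands for a first brick of length k + 1.
  record FirstBrick (a b : ℕ → C) : Set ℓ where
    field
      base : a 0 ≋ 1#
      step : ∀ n → a (suc n) ≋ ⨁ (upTo (suc n)) (λ k → b (suc k) ⊗ a (n ∸ k))

  -- Since `x 0` is 1, the term `k = 0` of the convolution is `y (suc n)`. Moving the remaining
  -- terms `P` to the other side replaces them by their negatives `N`.
  convolution⇒firstBrick : ∀ (x y : ℕ → C) → x 0 ≋ 1# → y 0 ≋ 1# →
    (∀ n → ⨁ (splitℕ (suc n)) (λ (k , l) → x k ⊗ y l) ≋ 0#) → FirstBrick y (λ k → ⊖ x k)
  convolution⇒firstBrick x y x0 y0 conv = record
    { base = y0
    ; step = λ n → begin
        y (suc n)                      ≈⟨ +-identityʳ _ ⟨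
        y (suc n) ⊕ 0#                 ≈⟨ +-congˡ (cancel n) ⟨
        y (suc n) ⊕ (P n ⊕ N n)        ≈⟨ +-assoc _ _ _ ⟨
        (y (suc n) ⊕ P n) ⊕ N n        ≈⟨ +-congʳ (total n) ⟩
        0# ⊕ N n                       ≈⟨ +-identityˡ _ ⟩
        N n                            ∎
    }
    where
    P N : ℕ → C
    P n = ⨁ (upTo (suc n)) (λ k → x (suc k) ⊗ y (n ∸ k))
    N n = ⨁ (upTo (suc n)) (λ k → ⊖ x (suc k) ⊗ y (n ∸ k))

    cancel : ∀ n → P n ⊕ N n ≋ 0#
    cancel n = begin
      P n ⊕ N n
        ≈⟨ ⨁-+ (upTo (suc n)) _ _ ⟨
      ⨁ (upTo (suc n)) (λ k → x (suc k) ⊗ y (n ∸ k) ⊕ ⊖ x (suc k) ⊗ y (n ∸ k))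
        ≈⟨ ⨁-cong (upTo (suc n)) (λ k → ≈-trans (≈-sym (distribʳ _ _ _))
             (≈-trans (*-congʳ (-‿inverseʳ _)) (zeroˡ _))) ⟩
      ⨁ (upTo (suc n)) (λ _ → 0#)
        ≈⟨ ⨁-0 (upTo (suc n)) ⟩
      0# ∎

    total : ∀ n → y (suc n) ⊕ P n ≋ 0#
    total n = begin
      y (suc n) ⊕ P n
        ≈⟨ +-congʳ (≈-trans (*-congʳ x0) (*-identityˡ _)) ⟨
      x 0 ⊗ y (suc n) ⊕ P n
        ≡⟨ cong (x 0 ⊗ y (suc n) ⊕_) (trans (⨁-map _ (splitℕ n) _) (⨁-map _ (upTo (suc n)) _)) ⟨
      ⨁ ((0 , suc n) ∷ map (λ (k , l) → suc k , l) (splitℕ n)) (λ (k , l) → x k ⊗ y l)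
        ≡⟨ cong (λ ps → ⨁ ps (λ (k , l) → x k ⊗ y l)) (splitℕ-suc n) ⟨
      ⨁ (splitℕ (suc n)) (λ (k , l) → x k ⊗ y l)
        ≈⟨ conv n ⟩
      0# ∎

  module _ {a b : ℕ → C} (ab : FirstBrick a b) where
    open FirstBrick ab

    -- Unfolding `step` and unfolding `bricks` both split off the first brick, so induction on the
    -- fuel matches them term by term.
    bricks-expansion : ∀ g s e → s ≤ e → e ∸ s ≤ g → a (e ∸ s) ≋ ⨁ (bricks g s e) (λ β → ⨂ (lengths β) b)
    bricks-expansion zero s e s≤e e∸s≤0 with s ℕ.≟ e
    ... | yes refl = ≈-trans (reflexive (cong a (ℕ.n∸n≡0 e))) (≈-trans base (≈-sym (+-identityʳ 1#)))
    ... | no  s≢e  = contradiction (ℕ.≤-antisym s≤e (ℕ.m∸n≡0⇒m≤n (ℕ.n≤0⇒n≡0 e∸s≤0))) s≢e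
    bricks-expansion (suc g) s e s≤e e∸s≤1+g with s ℕ.≟ e
    ... | yes refl = begin
      a (e ∸ e)   ≡⟨ cong a (ℕ.n∸n≡0 e) ⟩
      a 0         ≈⟨ base ⟩
      1#          ≈⟨ +-identityʳ 1# ⟨
      -- `e ∸ e` does not reduce to 0 for a variable `e`, so the emptiness of the list of first
      -- bricks has to be rewritten in.
      1# ⊕ 0#     ≡⟨ cong (λ j → 1# ⊕ ⨁ (concatMap (bricksFrom g e e) (upTo j)) (λ β → ⨂ (lengths β) b)) (ℕ.n∸n≡0 e) ⟨
      1# ⊕ ⨁ (concatMap (bricksFrom g e e) (upTo (e ∸ e))) (λ β → ⨂ (lengths β) b) ∎
    ... | no s≢e = begin
      a (e ∸ s)
        ≡⟨ cong a e∸s≡1+n ⟩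
      a (suc n)
        ≈⟨ step n ⟩
      ⨁ (upTo (suc n)) (λ k → b (suc k) ⊗ a (n ∸ k))
        ≡⟨ cong (λ j → ⨁ (upTo j) (λ k → b (suc k) ⊗ a (n ∸ k))) e∸s≡1+n ⟨
      ⨁ (upTo (e ∸ s)) (λ k → b (suc k) ⊗ a (n ∸ k))
        ≈⟨ ⨁-cong-∈ (upTo (e ∸ s)) (λ k∈ → first-brick _ (∈-upTo⁻ k∈)) ⟩
      ⨁ (upTo (e ∸ s)) (λ k → ⨁ (bricksFrom g s e k) (λ β → ⨂ (lengths β) b))
        ≈⟨ ⨁-concatMap (bricksFrom g s e) (upTo (e ∸ s)) _ ⟨
      ⨁ (concatMap (bricksFrom g s e) (upTo (e ∸ s))) (λ β → ⨂ (lengths β) b) ∎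
      where
      n : ℕ
      n = e ∸ suc s
      e∸s≡1+n : e ∸ s ≡ suc n
      e∸s≡1+n = ℕ.+-∸-assoc 1 (ℕ.≤∧≢⇒< s≤e s≢e)

      remaining : ∀ k → e ∸ (suc k ℕ.+ s) ≡ n ∸ k
      remaining k = trans (cong (e ∸_) (trans (ℕ.+-comm (suc k) s) (ℕ.+-suc s k)))
                          (sym (ℕ.∸-+-assoc e (suc s) k))

      first-brick : ∀ k → k < e ∸ s →
        b (suc k) ⊗ a (n ∸ k) ≋ ⨁ (bricksFrom g s e k) (λ β → ⨂ (lengths β) b)
      first-brick k k<e∸s = begin
        b (suc k) ⊗ a (n ∸ k)
          ≡⟨ cong₂ (λ i j → b i ⊗ a j) (ℕ.m+n∸n≡m (suc k) s) (remaining k) ⟨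
        b (suc k ℕ.+ s ∸ s) ⊗ a (e ∸ (suc k ℕ.+ s))
          ≈⟨ *-congˡ (bricks-expansion g (suc k ℕ.+ s) e
               (ℕ.m≤o∸n⇒m+n≤o (suc k) s≤e k<e∸s) (∸-suc-≤ {s} {e} k e∸s≤1+g)) ⟩
        b (suc k ℕ.+ s ∸ s) ⊗ ⨁ (bricks g (suc k ℕ.+ s) e) (λ β → ⨂ (lengths β) b)
          ≈⟨ ⨁-*ˡ (bricks g (suc k ℕ.+ s) e) _ _ ⟨
        ⨁ (bricks g (suc k ℕ.+ s) e) (λ β → b (suc k ℕ.+ s ∸ s) ⊗ ⨂ (lengths β) b)
          ≡⟨ ⨁-map (brick (s≤s (ℕ.m≤n+m s k))) (bricks g (suc k ℕ.+ s) e) _ ⟨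
        ⨁ (bricksFrom g s e k) (λ β → ⨂ (lengths β) b) ∎

    rowBricks-expansion : ∀ ds → ⨂ ds a ≋ ⨁ (rowBricks ds) (λ T → ⨂ (rowLengths T) b)
    rowBricks-expansion []       = ≈-sym (+-identityʳ 1#)
    rowBricks-expansion (d ∷ ds) = begin
      a d ⊗ ⨂ ds a
        ≈⟨ *-cong (bricks-expansion d 0 d z≤n ℕ.≤-refl) (rowBricks-expansion ds) ⟩
      ⨁ (bricks d 0 d) (λ β → ⨂ (lengths β) b) ⊗ ⨁ (rowBricks ds) (λ T → ⨂ (rowLengths T) b)
        ≈⟨ ⨁-product (bricks d 0 d) (rowBricks ds) _ _ ⟩
      ⨁ (bricks d 0 d) (λ β → ⨁ (rowBricks ds) λ T → ⨂ (lengths β) b ⊗ ⨂ (rowLengths T) b)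
        ≈⟨ ⨁-cong (bricks d 0 d) (λ β → ⨁-cong (rowBricks ds) λ T → ⨂-++ (lengths β) (rowLengths T) b) ⟨
      ⨁ (bricks d 0 d) (λ β → ⨁ (rowBricks ds) λ T → ⨂ (rowLengths (β ∷ T)) b)
        ≈⟨ ⨁-cartesianProductWith _∷_ (bricks d 0 d) (rowBricks ds) _ ⟨
      ⨁ (rowBricks (d ∷ ds)) (λ T → ⨂ (rowLengths T) b) ∎

  fillings-expansion : ∀ {k} {a b : Fin k → ℕ → C} → (∀ i → FirstBrick (a i) (b i)) → (v : Vec Partition k) →
    ⨂ (allFin k) (λ i → ⨂ (parts (lookup v i)) (a i)) ≋
    ⨁ (fillings v) (λ T → ⨂ (allFin k) λ i → ⨂ (lengthsAt T i) (b i))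
  fillings-expansion ab [] = ≈-sym (+-identityʳ 1#)
  fillings-expansion {suc k} {a} {b} ab (lam ∷ v) = begin
    ⨂ (allFin (suc k)) (λ i → ⨂ (parts (lookup (lam ∷ v) i)) (a i))
      ≡⟨ ⨂-allFin (λ i → ⨂ (parts (lookup (lam ∷ v) i)) (a i)) ⟩
    ⨂ (parts lam) (a Fin.zero) ⊗ ⨂ (allFin k) (λ i → ⨂ (parts (lookup v i)) (a (Fin.suc i)))
      ≈⟨ *-cong (rowBricks-expansion (ab Fin.zero) (parts lam)) (fillings-expansion (ab ∘ Fin.suc) v) ⟩
    ⨁ (rowBricks (parts lam)) (λ t → ⨂ (rowLengths t) (b Fin.zero)) ⊗
    ⨁ (fillings v) (λ T → ⨂ (allFin k) λ i → ⨂ (lengthsAt T i) (b (Fin.suc i)))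
      ≈⟨ ⨁-product (rowBricks (parts lam)) (fillings v) _ _ ⟩
    ⨁ (rowBricks (parts lam)) (λ t → ⨁ (fillings v) λ T →
      ⨂ (rowLengths t) (b Fin.zero) ⊗ ⨂ (allFin k) λ i → ⨂ (lengthsAt T i) (b (Fin.suc i)))
      ≈⟨ ⨁-cong (rowBricks (parts lam)) (λ t → ⨁-cong (fillings v) λ T →
           reflexive (⨂-allFin (λ i → ⨂ (lengthsAt (t ∷ T) i) (b i)))) ⟨
    ⨁ (rowBricks (parts lam)) (λ t → ⨁ (fillings v) λ T →
      ⨂ (allFin (suc k)) λ i → ⨂ (lengthsAt (t ∷ T) i) (b i))
      ≈⟨ ⨁-cartesianProductWith _∷_ (rowBricks (parts lam)) (fillings v) _ ⟨
    ⨁ (fillings (lam ∷ v)) (λ T → ⨂ (allFin (suc k)) λ i → ⨂ (lengthsAt T i) (b i)) ∎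

-- Sums over splittings

module ℚR = CommutativeRing ℚ.+-*-commutativeRing
open Sums ℚR.commutativeSemiring
open SemiringExp ℚR.semiring using (^-homo-*)
private
  module ℚ+ = CommutativeSemigroupProperties (CommutativeMonoid.commutativeSemigroup ℚR.+-commutativeMonoid)
  module ℚ* = CommutativeSemigroupProperties (CommutativeMonoid.commutativeSemigroup ℚR.*-commutativeMonoid)

-- Opaque so that the summand can be inferred by unification.
opaque
  ∑Split : Splitting A → A → (A → A → ℚ) → ℚ
  ∑Split f x Φ = ∑ (f x) (λ { (a , b) → Φ a b })

  ∑Split-def : ∀ (f : Splitting A) x (Φ : A → A → ℚ) → ∑Split f x Φ ≡ ∑ (f x) (λ { (a , b) → Φ a b })
  ∑Split-def f x Φ = refl

  ∑Split-cong : ∀ (f : Splitting A) x {Φ Ψ : A → A → ℚ} → (∀ a b → Φ a b ≡ Ψ a b) → ∑Split f x Φ ≡ ∑Split f x Ψ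
  ∑Split-cong f x eq = ⨁-cong (f x) (uncurry eq)

  ∑Split-swap : ∀ {B} (f : Splitting A) (g : Splitting B) x y (Φ : A → A → B → B → ℚ) →
    ∑Split f x (λ a b → ∑Split g y (Φ a b)) ≡ ∑Split g y (λ c d → ∑Split f x (λ a b → Φ a b c d))
  ∑Split-swap f g x y Φ = ⨁-swap (f x) (g y) (λ { (a , b) (c , d) → Φ a b c d })

  ∑Split-*ˡ : ∀ (f : Splitting A) x q (Φ : A → A → ℚ) → ∑Split f x (λ a b → q * Φ a b) ≡ q * ∑Split f x Φ
  ∑Split-*ˡ f x q Φ = ⨁-*ˡ (f x) q (λ { (a , b) → Φ a b })

  ∑Split-product : ∀ {B} (f : Splitting A) (g : Splitting B) x y (Φ : A → A → ℚ) (Ψ : B → B → ℚ) →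
    ∑Split f x Φ * ∑Split g y Ψ ≡ ∑Split f x (λ a b → ∑Split g y (λ c d → Φ a b * Ψ c d))
  ∑Split-product f g x y Φ Ψ = ⨁-product (f x) (g y) (λ { (a , b) → Φ a b }) (λ { (c , d) → Ψ c d })

  ∑Split-[] : ∀ (f : Splitting A) (Φ : List A → List A → ℚ) → ∑Split (splitWith f) [] Φ ≡ Φ [] []
  ∑Split-[] f Φ = ℚ.+-identityʳ (Φ [] [])

  ∑Split-∷ : ∀ (f : Splitting A) x xs (Φ : List A → List A → ℚ) →
    ∑Split (splitWith f) (x ∷ xs) Φ ≡ ∑Split f x (λ a b → ∑Split (splitWith f) xs (λ as bs → Φ (a ∷ as) (b ∷ bs)))
  ∑Split-∷ f x xs Φ = ⨁-cartesianProductWith _ (f x) (splitWith f xs) (λ { (a , b) → Φ a b })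

-- The laws are tested against an arbitrary `Φ` because the underlying lists of splittings agree
-- only up to order. The freedom of `Φ` also lets an induction over a list hide the sum over the
-- tail inside it.
Coassociative Cocommutative : Splitting A → Set
Coassociative {A} f = ∀ x (Φ : A → A → A → ℚ) →
  ∑Split f x (λ a b → ∑Split f a (λ c d → Φ c d b)) ≡ ∑Split f x (λ c e → ∑Split f e (λ d b → Φ c d b))
Cocommutative {A} f = ∀ x (Φ : A → A → ℚ) → ∑Split f x Φ ≡ ∑Split f x (flip Φ)

-- The weight is passed to `Φ` as a third argument because `w a + w b ≡ w x` can be expected only
-- for the pairs that occur in `f x`, not for all `a` and `b`.
AdditiveAt : (A → ℕ) → Splitting A → A → Set
AdditiveAt {A} w f x = ∀ (Φ : A → A → ℕ → ℚ) →
  ∑Split f x (λ a b → Φ a b (w a ℕ.+ w b)) ≡ ∑Split f x (λ a b → Φ a b (w x))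

Counit : (A → ℚ) → Splitting A → Set
Counit {A} ε f = ∀ x (Φ : A → ℚ) → ∑Split f x (λ a b → ε a * Φ b) ≡ Φ x

-- The dual form of multiplicativity of the substitution of r-th powers: `χ` will be the indicator
-- of divisibility by r, and `q` the division by r.
Rescaling : (A → ℚ) → (A → A) → Splitting A → Set
Rescaling {A} χ q f = ∀ x (Φ : A → A → ℚ) →
  ∑Split f x (λ a b → (χ a * χ b) * Φ (q a) (q b)) ≡ χ x * ∑Split f (q x) Φ

∏ : (A → ℚ) → List A → ℚ
∏ w []       = 1ℚ
∏ w (x ∷ xs) = w x * ∏ w xs

module _ (f : Splitting A) where
  private F = splitWith f

  -- Head and tail split independently. Swapping the splitting of the tail past the second splitting
  -- of the head makes the two splittings of the head adjacent, so that the law for `f` and the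
  -- induction hypothesis apply one after the other.
  splitWith-coassociative : Coassociative f → Coassociative F
  splitWith-coassociative coassoc []       Φ = begin
    ∑Split F [] (λ a b → ∑Split F a (λ c d → Φ c d b)) ≡⟨ ∑Split-[] f _ ⟩
    ∑Split F [] (λ c d → Φ c d [])                     ≡⟨ ∑Split-[] f _ ⟩
    Φ [] [] []                                         ≡⟨ ∑Split-[] f _ ⟨
    ∑Split F [] (λ d b → Φ [] d b)                     ≡⟨ ∑Split-[] f _ ⟨
    ∑Split F [] (λ c e → ∑Split F e (λ d b → Φ c d b)) ∎
    where open ≡-Reasoning
  splitWith-coassociative coassoc (x ∷ xs) Φ = begin
    ∑Split F (x ∷ xs) (λ a b → ∑Split F a (λ c d → Φ c d b))
      ≡⟨ ∑Split-∷ f x xs _ ⟩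
    (∑Split f x λ a b → ∑Split F xs λ as bs → ∑Split F (a ∷ as) λ c d → Φ c d (b ∷ bs))
      ≡⟨ ∑Split-cong f x (λ a b → ∑Split-cong F xs λ as bs → ∑Split-∷ f a as _) ⟩
    (∑Split f x λ a b → ∑Split F xs λ as bs → ∑Split f a λ c d → ∑Split F as λ cs ds →
       Φ (c ∷ cs) (d ∷ ds) (b ∷ bs))
      ≡⟨ ∑Split-cong f x (λ a b → ∑Split-swap F f xs a _) ⟩
    (∑Split f x λ a b → ∑Split f a λ c d → ∑Split F xs λ as bs → ∑Split F as λ cs ds →
       Φ (c ∷ cs) (d ∷ ds) (b ∷ bs))
      ≡⟨ coassoc x _ ⟩
    (∑Split f x λ c e → ∑Split f e λ d b → ∑Split F xs λ as bs → ∑Split F as λ cs ds →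
       Φ (c ∷ cs) (d ∷ ds) (b ∷ bs))
      ≡⟨ ∑Split-cong f x (λ c e → ∑Split-cong f e λ d b → splitWith-coassociative coassoc xs _) ⟩
    (∑Split f x λ c e → ∑Split f e λ d b → ∑Split F xs λ cs es → ∑Split F es λ ds bs →
       Φ (c ∷ cs) (d ∷ ds) (b ∷ bs))
      ≡⟨ ∑Split-cong f x (λ c e → ∑Split-swap F f xs e _) ⟨
    (∑Split f x λ c e → ∑Split F xs λ cs es → ∑Split f e λ d b → ∑Split F es λ ds bs →
       Φ (c ∷ cs) (d ∷ ds) (b ∷ bs))
      ≡⟨ ∑Split-cong f x (λ c e → ∑Split-cong F xs λ cs es → ∑Split-∷ f e es _) ⟨
    (∑Split f x λ c e → ∑Split F xs λ cs es → ∑Split F (e ∷ es) λ d b → Φ (c ∷ cs) d b)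
      ≡⟨ ∑Split-∷ f x xs _ ⟨
    ∑Split F (x ∷ xs) (λ c e → ∑Split F e (λ d b → Φ c d b)) ∎
    where open ≡-Reasoning

  splitWith-cocommutative : Cocommutative f → Cocommutative F
  splitWith-cocommutative cocomm []       Φ = trans (∑Split-[] f Φ) (sym (∑Split-[] f (flip Φ)))
  splitWith-cocommutative cocomm (x ∷ xs) Φ = begin
    ∑Split F (x ∷ xs) Φ
      ≡⟨ ∑Split-∷ f x xs Φ ⟩
    (∑Split f x λ a b → ∑Split F xs λ as bs → Φ (a ∷ as) (b ∷ bs))
      ≡⟨ cocomm x _ ⟩
    (∑Split f x λ a b → ∑Split F xs λ as bs → Φ (b ∷ as) (a ∷ bs))
      ≡⟨ ∑Split-cong f x (λ a b → splitWith-cocommutative cocomm xs _) ⟩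
    (∑Split f x λ a b → ∑Split F xs λ as bs → Φ (b ∷ bs) (a ∷ as))
      ≡⟨ ∑Split-∷ f x xs (flip Φ) ⟨
    ∑Split F (x ∷ xs) (flip Φ) ∎
    where open ≡-Reasoning

  splitWith-counit : ∀ ε → Counit ε f → Counit (∏ ε) F
  splitWith-counit ε counit []       Φ = trans (∑Split-[] f _) (ℚ.*-identityˡ (Φ []))
  splitWith-counit ε counit (x ∷ xs) Φ = begin
    ∑Split F (x ∷ xs) (λ a b → ∏ ε a * Φ b)
      ≡⟨ ∑Split-∷ f x xs _ ⟩
    (∑Split f x λ a b → ∑Split F xs λ as bs → (ε a * ∏ ε as) * Φ (b ∷ bs))
      ≡⟨ ∑Split-cong f x (λ a b → trans
           (∑Split-cong F xs λ as bs → ℚ.*-assoc (ε a) (∏ ε as) (Φ (b ∷ bs)))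
           (∑Split-*ˡ F xs (ε a) _)) ⟩
    (∑Split f x λ a b → ε a * ∑Split F xs λ as bs → ∏ ε as * Φ (b ∷ bs))
      ≡⟨ counit x _ ⟩
    (∑Split F xs λ as bs → ∏ ε as * Φ (x ∷ bs))
      ≡⟨ splitWith-counit ε counit xs _ ⟩
    Φ (x ∷ xs) ∎
    where open ≡-Reasoning

  -- The principle behind Euler products: series whose coefficients factor over the exponents
  -- multiply exponent by exponent.
  splitWith-convolve : ∀ u v w → (∀ x → ∑Split f x (λ a b → u a * v b) ≡ w x) →
    ∀ xs → ∑Split F xs (λ as bs → ∏ u as * ∏ v bs) ≡ ∏ w xs
  splitWith-convolve u v w conv []       = ∑Split-[] f _
  splitWith-convolve u v w conv (x ∷ xs) = begin
    ∑Split F (x ∷ xs) (λ a b → ∏ u a * ∏ v b)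
      ≡⟨ ∑Split-∷ f x xs _ ⟩
    (∑Split f x λ a b → ∑Split F xs λ as bs → (u a * ∏ u as) * (v b * ∏ v bs))
      ≡⟨ ∑Split-cong f x (λ a b → ∑Split-cong F xs λ as bs → ℚ*.interchange (u a) (∏ u as) (v b) (∏ v bs)) ⟩
    (∑Split f x λ a b → ∑Split F xs λ as bs → (u a * v b) * (∏ u as * ∏ v bs))
      ≡⟨ ∑Split-product f F x xs _ _ ⟨
    ∑Split f x (λ a b → u a * v b) * ∑Split F xs (λ as bs → ∏ u as * ∏ v bs)
      ≡⟨ cong₂ _*_ (conv x) (splitWith-convolve u v w conv xs) ⟩
    w x * ∏ w xs ∎
    where open ≡-Reasoning

  splitWith-additive-[] : ∀ W → W [] ≡ 0 → AdditiveAt W F []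
  splitWith-additive-[] W W-[] Φ = begin
    ∑Split F [] (λ a b → Φ a b (W a ℕ.+ W b)) ≡⟨ ∑Split-[] f _ ⟩
    Φ [] [] (W [] ℕ.+ W [])                   ≡⟨ cong (λ k → Φ [] [] (k ℕ.+ W [])) W-[] ⟩
    Φ [] [] (W [])                            ≡⟨ ∑Split-[] f _ ⟨
    ∑Split F [] (λ a b → Φ a b (W []))        ∎
    where open ≡-Reasoning

  -- The tail has its own weight `W′` because `degreeFrom i` weighs the remaining rows by
  -- `degreeFrom (suc i)`.
  splitWith-additive-∷ : ∀ w W W′ → (∀ x xs → W (x ∷ xs) ≡ w x ℕ.+ W′ xs) →
    ∀ {x xs} → AdditiveAt w f x → AdditiveAt W′ F xs → AdditiveAt W F (x ∷ xs)
  splitWith-additive-∷ w W W′ W-∷ {x} {xs} add add′ Φ = begin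
    ∑Split F (x ∷ xs) (λ a b → Φ a b (W a ℕ.+ W b))
      ≡⟨ ∑Split-∷ f x xs _ ⟩
    (∑Split f x λ a b → ∑Split F xs λ as bs → Φ (a ∷ as) (b ∷ bs) (W (a ∷ as) ℕ.+ W (b ∷ bs)))
      ≡⟨ ∑Split-cong f x (λ a b → ∑Split-cong F xs λ as bs → cong (Φ (a ∷ as) (b ∷ bs))
           (trans (cong₂ ℕ._+_ (W-∷ a as) (W-∷ b bs)) (interchange (w a) (W′ as) (w b) (W′ bs)))) ⟩
    (∑Split f x λ a b → ∑Split F xs λ as bs → Φ (a ∷ as) (b ∷ bs) ((w a ℕ.+ w b) ℕ.+ (W′ as ℕ.+ W′ bs)))
      ≡⟨ add (λ a b s → ∑Split F xs λ as bs → Φ (a ∷ as) (b ∷ bs) (s ℕ.+ (W′ as ℕ.+ W′ bs))) ⟩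
    (∑Split f x λ a b → ∑Split F xs λ as bs → Φ (a ∷ as) (b ∷ bs) (w x ℕ.+ (W′ as ℕ.+ W′ bs)))
      ≡⟨ ∑Split-cong f x (λ a b → add′ (λ as bs s → Φ (a ∷ as) (b ∷ bs) (w x ℕ.+ s))) ⟩
    (∑Split f x λ a b → ∑Split F xs λ as bs → Φ (a ∷ as) (b ∷ bs) (w x ℕ.+ W′ xs))
      ≡⟨ ∑Split-cong f x (λ a b → ∑Split-cong F xs λ as bs → cong (Φ (a ∷ as) (b ∷ bs)) (W-∷ x xs)) ⟨
    (∑Split f x λ a b → ∑Split F xs λ as bs → Φ (a ∷ as) (b ∷ bs) (W (x ∷ xs)))
      ≡⟨ ∑Split-∷ f x xs _ ⟨
    ∑Split F (x ∷ xs) (λ a b → Φ a b (W (x ∷ xs))) ∎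
    where
    open ≡-Reasoning
    open CommutativeSemigroupProperties ℕ.+-commutativeSemigroup using (interchange)

splitWith-rescaling : ∀ (f : Splitting A) χ q → Rescaling χ q f → Rescaling (∏ χ) (map q) (splitWith f)
splitWith-rescaling f χ q resc []       Φ =
  trans (∑Split-[] f _) (cong (1ℚ *_) (sym (∑Split-[] f Φ)))
splitWith-rescaling f χ q resc (x ∷ xs) Φ = begin
  ∑Split F (x ∷ xs) (λ a b → (∏ χ a * ∏ χ b) * Φ (map q a) (map q b))
    ≡⟨ ∑Split-∷ f x xs _ ⟩
  (∑Split f x λ a b → ∑Split F xs λ as bs →
    ((χ a * ∏ χ as) * (χ b * ∏ χ bs)) * Φ (q a ∷ map q as) (q b ∷ map q bs))
    ≡⟨ ∑Split-cong f x (λ a b → trans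
         (∑Split-cong F xs λ as bs → trans
           (cong (_* Φ (q a ∷ map q as) (q b ∷ map q bs)) (ℚ*.interchange (χ a) (∏ χ as) (χ b) (∏ χ bs)))
           (ℚ.*-assoc (χ a * χ b) _ _))
         (∑Split-*ˡ F xs (χ a * χ b) _)) ⟩
  (∑Split f x λ a b → (χ a * χ b) * ∑Split F xs λ as bs →
    (∏ χ as * ∏ χ bs) * Φ (q a ∷ map q as) (q b ∷ map q bs))
    ≡⟨ resc x (λ a′ b′ → ∑Split F xs λ as bs → (∏ χ as * ∏ χ bs) * Φ (a′ ∷ map q as) (b′ ∷ map q bs)) ⟩
  χ x * (∑Split f (q x) λ a′ b′ → ∑Split F xs λ as bs → (∏ χ as * ∏ χ bs) * Φ (a′ ∷ map q as) (b′ ∷ map q bs))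
    ≡⟨ cong (χ x *_) (∑Split-cong f (q x) λ a′ b′ → splitWith-rescaling f χ q resc xs _) ⟩
  χ x * (∑Split f (q x) λ a′ b′ → ∏ χ xs * ∑Split F (map q xs) λ as bs → Φ (a′ ∷ as) (b′ ∷ bs))
    ≡⟨ cong (χ x *_) (∑Split-*ˡ f (q x) (∏ χ xs) _) ⟩
  χ x * (∏ χ xs * ∑Split f (q x) λ a′ b′ → ∑Split F (map q xs) λ as bs → Φ (a′ ∷ as) (b′ ∷ bs))
    ≡⟨ ℚ.*-assoc (χ x) (∏ χ xs) _ ⟨
  (χ x * ∏ χ xs) * (∑Split f (q x) λ a′ b′ → ∑Split F (map q xs) λ as bs → Φ (a′ ∷ as) (b′ ∷ bs))
    ≡⟨ cong (∏ χ (x ∷ xs) *_) (∑Split-∷ f (q x) (map q xs) Φ) ⟨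
  ∏ χ (x ∷ xs) * ∑Split F (map q (x ∷ xs)) Φ ∎
  where
  open ≡-Reasoning
  F = splitWith f

-- Indicators as rational factors

private variable
  P Q : Set

𝕀 : Dec P → ℚ
𝕀 d = if ⌊ d ⌋ then 1ℚ else 0ℚ

𝕀-yes : (d : Dec P) → P → 𝕀 d ≡ 1ℚ
𝕀-yes (yes _) _ = refl
𝕀-yes (no ¬p) p = contradiction p ¬p

𝕀-no : (d : Dec P) → ¬ P → 𝕀 d ≡ 0ℚ
𝕀-no (yes p) ¬p = contradiction p ¬p
𝕀-no (no _)  _  = refl

𝕀-⇔ : (d : Dec P) (e : Dec Q) → (P → Q) → (Q → P) → 𝕀 d ≡ 𝕀 e
𝕀-⇔ (yes p) e f g = sym (𝕀-yes e (f p))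
𝕀-⇔ (no ¬p) e f g = sym (𝕀-no e (¬p ∘ g))

if-𝕀 : (d : Dec P) (q : ℚ) → (if ⌊ d ⌋ then q else 0ℚ) ≡ 𝕀 d * q
if-𝕀 (yes _) q = sym (ℚ.*-identityˡ q)
if-𝕀 (no  _) q = sym (ℚ.*-zeroˡ q)

𝕀-× : (d : Dec P) (e : Dec Q) → 𝕀 (d ×-dec e) ≡ 𝕀 d * 𝕀 e
𝕀-× (yes _) (yes _) = refl
𝕀-× (yes _) (no _)  = refl
𝕀-× (no _)  (yes _) = refl
𝕀-× (no _)  (no _)  = refl

𝕀-all : {R : A → Set} (R? : Decidable R) → ∀ xs → 𝕀 (all? R? xs) ≡ ∏ (λ x → 𝕀 (R? x)) xs
𝕀-all R? []       = refl
𝕀-all R? (x ∷ xs) = begin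
  𝕀 (all? R? (x ∷ xs))          ≡⟨ 𝕀-⇔ (all? R? (x ∷ xs)) (R? x ×-dec all? R? xs) All.uncons (uncurry _∷_) ⟩
  𝕀 (R? x ×-dec all? R? xs)     ≡⟨ 𝕀-× (R? x) (all? R? xs) ⟩
  𝕀 (R? x) * 𝕀 (all? R? xs)     ≡⟨ cong (𝕀 (R? x) *_) (𝕀-all R? xs) ⟩
  ∏ (λ x → 𝕀 (R? x)) (x ∷ xs)   ∎
  where open ≡-Reasoning

∏-cong : ∀ {u v : A → ℚ} → (∀ x → u x ≡ v x) → ∀ xs → ∏ u xs ≡ ∏ v xs
∏-cong eq []       = refl
∏-cong eq (x ∷ xs) = cong₂ _*_ (eq x) (∏-cong eq xs)

∏-1 : ∀ (xs : List A) → ∏ (λ _ → 1ℚ) xs ≡ 1ℚ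
∏-1 []       = refl
∏-1 (x ∷ xs) = trans (ℚ.*-identityˡ _) (∏-1 xs)

∏-* : ∀ (u v : A → ℚ) xs → ∏ (λ x → u x * v x) xs ≡ ∏ u xs * ∏ v xs
∏-* u v []       = refl
∏-* u v (x ∷ xs) = trans (cong ((u x * v x) *_) (∏-* u v xs)) (ℚ*.interchange (u x) (v x) (∏ u xs) (∏ v xs))

-- Splittings of a single exponent

opaque
  unfolding ∑Split

  ∑ℕ-zero : ∀ Φ → ∑Split splitℕ 0 Φ ≡ Φ 0 0
  ∑ℕ-zero Φ = ℚ.+-identityʳ (Φ 0 0)

  ∑ℕ-suc : ∀ e Φ → ∑Split splitℕ (suc e) Φ ≡ Φ 0 (suc e) + ∑Split splitℕ e (λ a b → Φ (suc a) b)
  ∑ℕ-suc e Φ = begin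
    ∑ (splitℕ (suc e)) (uncurry Φ)
      ≡⟨ cong (λ ps → ∑ ps (uncurry Φ)) (splitℕ-suc e) ⟩
    Φ 0 (suc e) + ∑ (map (λ (a , b) → suc a , b) (splitℕ e)) (uncurry Φ)
      ≡⟨ cong (Φ 0 (suc e) +_) (⨁-map _ (splitℕ e) (uncurry Φ)) ⟩
    Φ 0 (suc e) + ∑ (splitℕ e) (λ (a , b) → Φ (suc a) b) ∎
    where open ≡-Reasoning

  ∑Split-+ : ∀ (f : Splitting A) x (Φ Ψ : A → A → ℚ) →
    ∑Split f x (λ a b → Φ a b + Ψ a b) ≡ ∑Split f x Φ + ∑Split f x Ψ
  ∑Split-+ f x Φ Ψ = ⨁-+ (f x) (uncurry Φ) (uncurry Ψ)

  ∑Split-0 : ∀ (f : Splitting A) x → ∑Split f x (λ _ _ → 0ℚ) ≡ 0ℚ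
  ∑Split-0 f x = ⨁-0 (f x)

-- Peels off the pair at the opposite end from `∑ℕ-suc`. This is what reversing a splitting needs,
-- and also the evaluation of summands that depend on the second entry.
∑ℕ-suc′ : ∀ e Φ → ∑Split splitℕ (suc e) Φ ≡ Φ (suc e) 0 + ∑Split splitℕ e (λ a b → Φ a (suc b))
∑ℕ-suc′ zero Φ = begin
  ∑Split splitℕ 1 Φ                               ≡⟨ ∑ℕ-suc 0 Φ ⟩
  Φ 0 1 + ∑Split splitℕ 0 (λ a b → Φ (suc a) b)   ≡⟨ cong (Φ 0 1 +_) (∑ℕ-zero _) ⟩
  Φ 0 1 + Φ 1 0                                    ≡⟨ ℚ.+-comm (Φ 0 1) (Φ 1 0) ⟩
  Φ 1 0 + Φ 0 1                                    ≡⟨ cong (Φ 1 0 +_) (∑ℕ-zero _) ⟨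
  Φ 1 0 + ∑Split splitℕ 0 (λ a b → Φ a (suc b))   ∎
  where open ≡-Reasoning
∑ℕ-suc′ (suc e) Φ = begin
  ∑Split splitℕ (2 ℕ.+ e) Φ
    ≡⟨ ∑ℕ-suc (suc e) Φ ⟩
  Φ 0 (2 ℕ.+ e) + ∑Split splitℕ (suc e) (λ a b → Φ (suc a) b)
    ≡⟨ cong (Φ 0 (2 ℕ.+ e) +_) (∑ℕ-suc′ e _) ⟩
  Φ 0 (2 ℕ.+ e) + (Φ (2 ℕ.+ e) 0 + ∑Split splitℕ e (λ a b → Φ (suc a) (suc b)))
    ≡⟨ ℚ+.x∙yz≈y∙xz (Φ 0 (2 ℕ.+ e)) (Φ (2 ℕ.+ e) 0) _ ⟩
  Φ (2 ℕ.+ e) 0 + (Φ 0 (2 ℕ.+ e) + ∑Split splitℕ e (λ a b → Φ (suc a) (suc b)))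
    ≡⟨ cong (Φ (2 ℕ.+ e) 0 +_) (∑ℕ-suc e _) ⟨
  Φ (2 ℕ.+ e) 0 + ∑Split splitℕ (suc e) (λ a b → Φ a (suc b)) ∎
  where
  open ≡-Reasoning
-- The triples with first entry 0 are gathered first: on the left they come from `a = 0` and from
-- the leading term in the splitting of each `suc a`, and together they form the sum of `Φ 0` over
-- the splittings of `suc e`. The other triples fall to the induction hypothesis.
splitℕ-coassociative : Coassociative splitℕ
splitℕ-coassociative zero Φ = begin
  ∑Split splitℕ 0 (λ a b → ∑Split splitℕ a (λ c d → Φ c d b)) ≡⟨ ∑ℕ-zero _ ⟩
  ∑Split splitℕ 0 (λ c d → Φ c d 0)                           ≡⟨ ∑ℕ-zero _ ⟩
  Φ 0 0 0                                                     ≡⟨ ∑ℕ-zero _ ⟨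
  ∑Split splitℕ 0 (λ d b → Φ 0 d b)                           ≡⟨ ∑ℕ-zero _ ⟨
  ∑Split splitℕ 0 (λ c e → ∑Split splitℕ e (λ d b → Φ c d b)) ∎
  where open ≡-Reasoning
splitℕ-coassociative (suc e) Φ = begin
  ∑Split splitℕ (suc e) (λ a b → ∑Split splitℕ a (λ c d → Φ c d b))
    ≡⟨ ∑ℕ-suc e _ ⟩
  ∑Split splitℕ 0 (λ c d → Φ c d (suc e)) + ∑Split splitℕ e (λ a b → ∑Split splitℕ (suc a) (λ c d → Φ c d b))
    ≡⟨ cong₂ _+_ (∑ℕ-zero _) (trans (∑Split-cong splitℕ e λ a b → ∑ℕ-suc a _) (∑Split-+ splitℕ e _ _)) ⟩
  Φ 0 0 (suc e) + (∑Split splitℕ e (λ a b → Φ 0 (suc a) b) +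
                   ∑Split splitℕ e (λ a b → ∑Split splitℕ a (λ c d → Φ (suc c) d b)))
    ≡⟨ ℚ.+-assoc (Φ 0 0 (suc e)) _ _ ⟨
  (Φ 0 0 (suc e) + ∑Split splitℕ e (λ a b → Φ 0 (suc a) b)) +
                   ∑Split splitℕ e (λ a b → ∑Split splitℕ a (λ c d → Φ (suc c) d b))
    ≡⟨ cong₂ _+_ (sym (∑ℕ-suc e _)) (splitℕ-coassociative e _) ⟩
  ∑Split splitℕ (suc e) (Φ 0) + ∑Split splitℕ e (λ c e → ∑Split splitℕ e (λ d b → Φ (suc c) d b))
    ≡⟨ ∑ℕ-suc e _ ⟨
  ∑Split splitℕ (suc e) (λ c e → ∑Split splitℕ e (λ d b → Φ c d b)) ∎
  where open ≡-Reasoning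

splitℕ-cocommutative : Cocommutative splitℕ
splitℕ-cocommutative zero    Φ = trans (∑ℕ-zero Φ) (sym (∑ℕ-zero (flip Φ)))
splitℕ-cocommutative (suc e) Φ = begin
  ∑Split splitℕ (suc e) Φ                                   ≡⟨ ∑ℕ-suc e Φ ⟩
  Φ 0 (suc e) + ∑Split splitℕ e (λ a b → Φ (suc a) b)       ≡⟨ cong (Φ 0 (suc e) +_) (splitℕ-cocommutative e _) ⟩
  Φ 0 (suc e) + ∑Split splitℕ e (λ a b → Φ (suc b) a)       ≡⟨ ∑ℕ-suc′ e (flip Φ) ⟨
  ∑Split splitℕ (suc e) (flip Φ)                            ∎
  where open ≡-Reasoning

splitℕ-additive : ∀ e → AdditiveAt (λ e → e) splitℕ e
splitℕ-additive zero    Φ = trans (∑ℕ-zero _) (sym (∑ℕ-zero _))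
splitℕ-additive (suc e) Φ = trans (∑ℕ-suc e _) (trans
  (cong (Φ 0 (suc e) (suc e) +_) (splitℕ-additive e (λ a b s → Φ (suc a) b (suc s))))
  (sym (∑ℕ-suc e _)))

splitℕ-counit : Counit (λ e → 𝕀 (e ℕ.≟ 0)) splitℕ
splitℕ-counit zero    Φ = trans (∑ℕ-zero _) (ℚ.*-identityˡ (Φ 0))
splitℕ-counit (suc e) Φ = begin
  ∑Split splitℕ (suc e) (λ a b → 𝕀 (a ℕ.≟ 0) * Φ b)
    ≡⟨ ∑ℕ-suc e _ ⟩
  1ℚ * Φ (suc e) + ∑Split splitℕ e (λ a b → 0ℚ * Φ b)
    ≡⟨ cong₂ _+_ (ℚ.*-identityˡ (Φ (suc e)))
         (trans (∑Split-cong splitℕ e λ a b → ℚ.*-zeroˡ (Φ b)) (∑Split-0 splitℕ e)) ⟩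
  Φ (suc e) + 0ℚ
    ≡⟨ ℚ.+-identityʳ (Φ (suc e)) ⟩
  Φ (suc e) ∎
  where open ≡-Reasoning

-- The contribution of a variable with the given exponent to E, which is the inverse series of H.
sign : ℕ → ℚ
sign 0             = 1ℚ
sign 1             = - 1ℚ
sign (suc (suc _)) = 0ℚ

-- This is (1 + x + x² + ...)(1 - x) = 1. Only `b = 0` and `b = 1` contribute, hence two steps of
-- `∑ℕ-suc′`.
splitℕ-sign : ∀ e → ∑Split splitℕ e (λ a b → 1ℚ * sign b) ≡ 𝕀 (e ℕ.≟ 0)
splitℕ-sign zero          = ∑ℕ-zero _
splitℕ-sign (suc zero)    = trans (∑ℕ-suc 0 _) (cong (- 1ℚ +_) (∑ℕ-zero _))
splitℕ-sign (suc (suc e)) = begin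
  ∑Split splitℕ (2 ℕ.+ e) (λ a b → 1ℚ * sign b)
    ≡⟨ trans (∑ℕ-suc′ (suc e) _) (cong (1ℚ +_) (∑ℕ-suc′ e _)) ⟩
  1ℚ + (- 1ℚ + ∑Split splitℕ e (λ _ _ → 0ℚ))
    ≡⟨ cong (λ q → 1ℚ + (- 1ℚ + q)) (∑Split-0 splitℕ e) ⟩
  0ℚ ∎
  where open ≡-Reasoning

-- At most one splitting of `d` is the pair `k`, `l`. This collapses a sum over the degrees of two
-- factors to a condition on their total degree.
∑ℕ-𝕀 : ∀ d k l → ∑Split splitℕ d (λ a b → 𝕀 (k ℕ.≟ a) * 𝕀 (l ℕ.≟ b)) ≡ 𝕀 (k ℕ.+ l ℕ.≟ d)
∑ℕ-𝕀 zero zero    l = trans (∑ℕ-zero _) (ℚ.*-identityˡ _)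
∑ℕ-𝕀 zero (suc k) l = trans (∑ℕ-zero _) (ℚ.*-zeroˡ (𝕀 (l ℕ.≟ 0)))
∑ℕ-𝕀 (suc d) zero l = begin
  ∑Split splitℕ (suc d) (λ a b → 𝕀 (0 ℕ.≟ a) * 𝕀 (l ℕ.≟ b))
    ≡⟨ ∑ℕ-suc d _ ⟩
  1ℚ * 𝕀 (l ℕ.≟ suc d) + ∑Split splitℕ d (λ a b → 0ℚ * 𝕀 (l ℕ.≟ b))
    ≡⟨ cong₂ _+_ (ℚ.*-identityˡ (𝕀 (l ℕ.≟ suc d)))
         (trans (∑Split-cong splitℕ d λ a b → ℚ.*-zeroˡ (𝕀 (l ℕ.≟ b))) (∑Split-0 splitℕ d)) ⟩
  𝕀 (l ℕ.≟ suc d) + 0ℚ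
    ≡⟨ ℚ.+-identityʳ _ ⟩
  𝕀 (l ℕ.≟ suc d) ∎
  where open ≡-Reasoning
∑ℕ-𝕀 (suc d) (suc k) l = begin
  ∑Split splitℕ (suc d) (λ a b → 𝕀 (suc k ℕ.≟ a) * 𝕀 (l ℕ.≟ b))
    ≡⟨ ∑ℕ-suc d _ ⟩
  0ℚ * 𝕀 (l ℕ.≟ suc d) + ∑Split splitℕ d (λ a b → 𝕀 (suc k ℕ.≟ suc a) * 𝕀 (l ℕ.≟ b))
    ≡⟨ cong₂ _+_ (ℚ.*-zeroˡ (𝕀 (l ℕ.≟ suc d)))
         (∑Split-cong splitℕ d λ a b → cong (_* 𝕀 (l ℕ.≟ b)) (𝕀-suc k a)) ⟩
  0ℚ + ∑Split splitℕ d (λ a b → 𝕀 (k ℕ.≟ a) * 𝕀 (l ℕ.≟ b))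
    ≡⟨ trans (ℚ.+-identityˡ _) (∑ℕ-𝕀 d k l) ⟩
  𝕀 (k ℕ.+ l ℕ.≟ d)
    ≡⟨ 𝕀-suc (k ℕ.+ l) d ⟨
  𝕀 (suc k ℕ.+ l ℕ.≟ suc d) ∎
  where
  open ≡-Reasoning
  𝕀-suc : ∀ m n → 𝕀 (suc m ℕ.≟ suc n) ≡ 𝕀 (m ℕ.≟ n)
  𝕀-suc m n = 𝕀-⇔ (suc m ℕ.≟ suc n) (m ℕ.≟ n) ℕ.suc-injective (cong suc)

∑ℕ-vanish : ∀ e Φ → (∀ a b → a ≤ e → Φ a b ≡ 0ℚ) → ∑Split splitℕ e Φ ≡ 0ℚ
∑ℕ-vanish zero    Φ Φ≡0 = trans (∑ℕ-zero Φ) (Φ≡0 0 0 z≤n)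
∑ℕ-vanish (suc e) Φ Φ≡0 = trans (∑ℕ-suc e Φ)
  (cong₂ _+_ (Φ≡0 0 (suc e) z≤n) (∑ℕ-vanish e _ λ a b a≤e → Φ≡0 (suc a) b (s≤s a≤e)))

∑ℕ-drop : ∀ k e Φ → (∀ a b → a < k → Φ a b ≡ 0ℚ) →
  ∑Split splitℕ (k ℕ.+ e) Φ ≡ ∑Split splitℕ e (λ a b → Φ (k ℕ.+ a) b)
∑ℕ-drop zero    e Φ Φ≡0 = refl
∑ℕ-drop (suc k) e Φ Φ≡0 = begin
  ∑Split splitℕ (suc (k ℕ.+ e)) Φ
    ≡⟨ ∑ℕ-suc (k ℕ.+ e) Φ ⟩
  Φ 0 (suc (k ℕ.+ e)) + ∑Split splitℕ (k ℕ.+ e) (λ a b → Φ (suc a) b)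
    ≡⟨ cong₂ _+_ (Φ≡0 0 _ (s≤s z≤n)) (∑ℕ-drop k e _ λ a b a<k → Φ≡0 (suc a) b (s≤s a<k)) ⟩
  0ℚ + ∑Split splitℕ e (λ a b → Φ (suc k ℕ.+ a) b)
    ≡⟨ ℚ.+-identityˡ _ ⟩
  ∑Split splitℕ e (λ a b → Φ (suc k ℕ.+ a) b) ∎
  where open ≡-Reasoning

-- Divisibility by r in a single exponent

module _ (r-1 : ℕ) where
  private
    open ≡-Reasoning

    r = suc r-1

    χ : ℕ → ℚ
    χ e = 𝕀 (r ∣? e)

    χ-small : ∀ a → a < r-1 → χ (suc a) ≡ 0ℚ
    χ-small a a<r-1 = 𝕀-no (r ∣? suc a) λ r∣1+a → ℕ.<⇒≱ (s≤s a<r-1) (∣⇒≤ r∣1+a)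

    χ-+ : ∀ a → χ (r ℕ.+ a) ≡ χ a
    χ-+ a = 𝕀-⇔ (r ∣? (r ℕ.+ a)) (r ∣? a) (λ p → ∣m+n∣m⇒∣n p ∣-refl) (∣m∣n⇒∣m+n ∣-refl)

    +-/ : ∀ a → (r ℕ.+ a) ℕ./ r ≡ suc (a ℕ./ r)
    +-/ a = trans (ℕ.m/n≡1+[m∸n]/n {r ℕ.+ a} {r} (ℕ.m≤m+n r a)) (cong (λ k → suc (k ℕ./ r)) (ℕ.m+n∸m≡n r a))

    χ0 : χ 0 ≡ 1ℚ
    χ0 = 𝕀-yes (r ∣? 0) (r ∣0)

    Ψ : (ℕ → ℕ → ℚ) → ℕ → ℕ → ℚ
    Ψ Φ a b = (χ a * χ b) * Φ (a ℕ./ r) (b ℕ./ r)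

    Ψ-0 : ∀ Φ b → Ψ Φ 0 b ≡ χ b * Φ 0 (b ℕ./ r)
    Ψ-0 Φ b = cong₂ (λ p k → p * Φ k (b ℕ./ r))
      (trans (cong (_* χ b) χ0) (ℚ.*-identityˡ (χ b))) (ℕ.0/n≡0 r)

    Ψ-small : ∀ Φ a b → a < r-1 → Ψ Φ (suc a) b ≡ 0ℚ
    Ψ-small Φ a b a<r-1 = trans
      (cong (_* Φ (suc a ℕ./ r) (b ℕ./ r)) (trans (cong (_* χ b) (χ-small a a<r-1)) (ℚ.*-zeroˡ (χ b))))
      (ℚ.*-zeroˡ (Φ (suc a ℕ./ r) (b ℕ./ r)))

    Rescales : ℕ → Set
    Rescales e = ∀ (Φ : ℕ → ℕ → ℚ) → ∑Split splitℕ e (Ψ Φ) ≡ χ e * ∑Split splitℕ (e ℕ./ r) Φ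

    -- No exponent strictly between 0 and `r` is divisible by `r`, so both sides vanish unless `e`
    -- is 0.
    below : ∀ e → e < r → Rescales e
    below zero e<r Φ = begin
      ∑Split splitℕ 0 (Ψ Φ)               ≡⟨ ∑ℕ-zero (Ψ Φ) ⟩
      Ψ Φ 0 0                             ≡⟨ Ψ-0 Φ 0 ⟩
      χ 0 * Φ 0 (0 ℕ./ r)                 ≡⟨ cong (λ k → χ 0 * Φ 0 k) (ℕ.0/n≡0 r) ⟩
      χ 0 * Φ 0 0                         ≡⟨ cong (χ 0 *_) (∑ℕ-zero Φ) ⟨
      χ 0 * ∑Split splitℕ 0 Φ             ≡⟨ cong (λ k → χ 0 * ∑Split splitℕ k Φ) (ℕ.0/n≡0 r) ⟨
      χ 0 * ∑Split splitℕ (0 ℕ./ r) Φ     ∎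
    below (suc e) (s≤s e<r-1) Φ = begin
      ∑Split splitℕ (suc e) (Ψ Φ)
        ≡⟨ ∑ℕ-suc e (Ψ Φ) ⟩
      Ψ Φ 0 (suc e) + ∑Split splitℕ e (λ a b → Ψ Φ (suc a) b)
        ≡⟨ cong₂ _+_ (Ψ-0 Φ (suc e)) (∑ℕ-vanish e _ λ a b a≤e → Ψ-small Φ a b (ℕ.≤-<-trans a≤e e<r-1)) ⟩
      χ (suc e) * Φ 0 (suc e ℕ./ r) + 0ℚ
        ≡⟨ trans (ℚ.+-identityʳ _) (cong (_* Φ 0 (suc e ℕ./ r)) (χ-small e e<r-1)) ⟩
      0ℚ * Φ 0 (suc e ℕ./ r)
        ≡⟨ trans (ℚ.*-zeroˡ (Φ 0 (suc e ℕ./ r))) (sym (ℚ.*-zeroˡ (∑Split splitℕ (suc e ℕ./ r) Φ))) ⟩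
      0ℚ * ∑Split splitℕ (suc e ℕ./ r) Φ
        ≡⟨ cong (_* ∑Split splitℕ (suc e ℕ./ r) Φ) (χ-small e e<r-1) ⟨
      χ (suc e) * ∑Split splitℕ (suc e ℕ./ r) Φ ∎

    -- First entries from 1 to `r - 1` contribute nothing. The entry 0 gives the leading term in the
    -- splitting of `suc (e / r)`, and an entry `r + a` raises the quotient of `a` by one, so the
    -- hypothesis is used for `Φ ∘ suc`.
    shift : ∀ e → Rescales e → Rescales (r ℕ.+ e)
    shift e ih Φ = begin
      ∑Split splitℕ (suc (r-1 ℕ.+ e)) (Ψ Φ)
        ≡⟨ ∑ℕ-suc (r-1 ℕ.+ e) (Ψ Φ) ⟩
      Ψ Φ 0 (r ℕ.+ e) + ∑Split splitℕ (r-1 ℕ.+ e) (λ a b → Ψ Φ (suc a) b)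
        ≡⟨ cong₂ _+_ (Ψ-0 Φ (r ℕ.+ e)) (∑ℕ-drop r-1 e _ λ a b a<r-1 → Ψ-small Φ a b a<r-1) ⟩
      χ (r ℕ.+ e) * Φ 0 ((r ℕ.+ e) ℕ./ r) + ∑Split splitℕ e (λ a b → Ψ Φ (r ℕ.+ a) b)
        ≡⟨ cong₂ _+_ (cong₂ (λ p k → p * Φ 0 k) (χ-+ e) (+-/ e))
             (∑Split-cong splitℕ e λ a b → cong₂ (λ p k → (p * χ b) * Φ k (b ℕ./ r)) (χ-+ a) (+-/ a)) ⟩
      χ e * Φ 0 (suc (e ℕ./ r)) + ∑Split splitℕ e (Ψ (Φ ∘ suc))
        ≡⟨ cong (χ e * Φ 0 (suc (e ℕ./ r)) +_) (ih (Φ ∘ suc)) ⟩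
      χ e * Φ 0 (suc (e ℕ./ r)) + χ e * ∑Split splitℕ (e ℕ./ r) (Φ ∘ suc)
        ≡⟨ ℚ.*-distribˡ-+ (χ e) _ _ ⟨
      χ e * (Φ 0 (suc (e ℕ./ r)) + ∑Split splitℕ (e ℕ./ r) (Φ ∘ suc))
        ≡⟨ cong (χ e *_) (∑ℕ-suc (e ℕ./ r) Φ) ⟨
      χ e * ∑Split splitℕ (suc (e ℕ./ r)) Φ
        ≡⟨ cong₂ (λ p k → p * ∑Split splitℕ k Φ) (χ-+ e) (+-/ e) ⟨
      χ (r ℕ.+ e) * ∑Split splitℕ ((r ℕ.+ e) ℕ./ r) Φ ∎

  splitℕ-rescaling : Rescaling (λ e → 𝕀 (r ∣? e)) (ℕ._/ r) splitℕ
  splitℕ-rescaling = <-rec Rescales step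
    where
    step : ∀ e → (∀ {e′} → e′ < e → Rescales e′) → Rescales e
    step e ih with e ℕ.<? r
    ... | yes e<r = below e e<r
    ... | no  e≮r = subst Rescales (ℕ.m+[n∸m]≡n r≤e) (shift (e ∸ r) (ih (ℕ.∸-monoʳ-< (s≤s z≤n) r≤e)))
      where
      r≤e : r ≤ e
      r≤e = ℕ.≮⇒≥ e≮r

-- The ring of series

-- Definitionally `factorisations`, in the form to which the laws for `splitWith` apply twice, once
-- for tables and once for rows.
splitMonomial : Splitting Monomial
splitMonomial = splitWith (splitWith splitℕ)

∙-∑Split : ∀ F G m → (F ∙ G) m ≡ ∑Split splitMonomial m (λ a b → F a * G b)
∙-∑Split F G m = sym (∑Split-def splitMonomial m (λ a b → F a * G b))

isOne : Monomial → ℚ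
isOne = ∏ (∏ (λ e → 𝕀 (e ℕ.≟ 0)))

𝟙-∏ : ∀ m → 𝟙 m ≡ isOne m
𝟙-∏ m = trans (𝕀-all (all? (ℕ._≟ 0)) m) (∏-cong (𝕀-all (ℕ._≟ 0)) m)

infixl 6 _⊞_
infix 8 ⊟_
_⊞_ : Series → Series → Series
(F ⊞ G) m = F m + G m

⊟_ : Series → Series
(⊟ F) m = - F m

𝟘 : Series
𝟘 _ = 0ℚ

∙-cong : ∀ {F F′ G G′} → F ≈ F′ → G ≈ G′ → F ∙ G ≈ F′ ∙ G′
∙-cong {F} {F′} {G} {G′} F≈F′ G≈G′ m = begin
  (F ∙ G) m                                       ≡⟨ ∙-∑Split F G m ⟩
  ∑Split splitMonomial m (λ a b → F a * G b)      ≡⟨ ∑Split-cong splitMonomial m (λ a b → cong₂ _*_ (F≈F′ a) (G≈G′ b)) ⟩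
  ∑Split splitMonomial m (λ a b → F′ a * G′ b)    ≡⟨ ∙-∑Split F′ G′ m ⟨
  (F′ ∙ G′) m                                     ∎
  where open ≡-Reasoning

∙-comm : ∀ F G → F ∙ G ≈ G ∙ F
∙-comm F G m = begin
  (F ∙ G) m                                       ≡⟨ ∙-∑Split F G m ⟩
  ∑Split splitMonomial m (λ a b → F a * G b)
    ≡⟨ splitWith-cocommutative _ (splitWith-cocommutative _ splitℕ-cocommutative) m _ ⟩
  ∑Split splitMonomial m (λ a b → F b * G a)      ≡⟨ ∑Split-cong splitMonomial m (λ a b → ℚ.*-comm (F b) (G a)) ⟩
  ∑Split splitMonomial m (λ a b → G a * F b)      ≡⟨ ∙-∑Split G F m ⟨
  (G ∙ F) m                                       ∎
  where open ≡-Reasoning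

∙-assoc : ∀ F G K → (F ∙ G) ∙ K ≈ F ∙ (G ∙ K)
∙-assoc F G K m = begin
  ((F ∙ G) ∙ K) m
    ≡⟨ ∙-∑Split (F ∙ G) K m ⟩
  ∑Split splitMonomial m (λ a b → (F ∙ G) a * K b)
    ≡⟨ ∑Split-cong splitMonomial m (λ a b → trans (ℚ.*-comm _ (K b)) (trans
         (cong (K b *_) (∙-∑Split F G a)) (sym (∑Split-*ˡ splitMonomial a (K b) _)))) ⟩
  ∑Split splitMonomial m (λ a b → ∑Split splitMonomial a (λ c d → K b * (F c * G d)))
    ≡⟨ splitWith-coassociative _ (splitWith-coassociative _ splitℕ-coassociative) m (λ c d b → K b * (F c * G d)) ⟩
  ∑Split splitMonomial m (λ c e → ∑Split splitMonomial e (λ d b → K b * (F c * G d)))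
    ≡⟨ ∑Split-cong splitMonomial m (λ c e → trans
         (∑Split-cong splitMonomial e λ d b → trans (ℚ.*-comm (K b) _) (ℚ.*-assoc (F c) (G d) (K b)))
         (∑Split-*ˡ splitMonomial e (F c) _)) ⟩
  ∑Split splitMonomial m (λ c e → F c * ∑Split splitMonomial e (λ d b → G d * K b))
    ≡⟨ ∑Split-cong splitMonomial m (λ c e → cong (F c *_) (∙-∑Split G K e)) ⟨
  ∑Split splitMonomial m (λ c e → F c * (G ∙ K) e)
    ≡⟨ ∙-∑Split F (G ∙ K) m ⟨
  (F ∙ (G ∙ K)) m ∎
  where open ≡-Reasoning

∙-identityˡ : ∀ F → 𝟙 ∙ F ≈ F
∙-identityˡ F m = begin
  (𝟙 ∙ F) m                                        ≡⟨ ∙-∑Split 𝟙 F m ⟩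
  ∑Split splitMonomial m (λ a b → 𝟙 a * F b)       ≡⟨ ∑Split-cong splitMonomial m (λ a b → cong (_* F b) (𝟙-∏ a)) ⟩
  ∑Split splitMonomial m (λ a b → isOne a * F b)   ≡⟨ splitWith-counit _ _ (splitWith-counit _ _ splitℕ-counit) m F ⟩
  F m                                              ∎
  where open ≡-Reasoning

∙-distribʳ : ∀ F G K → (G ⊞ K) ∙ F ≈ (G ∙ F) ⊞ (K ∙ F)
∙-distribʳ F G K m = begin
  ((G ⊞ K) ∙ F) m
    ≡⟨ ∙-∑Split (G ⊞ K) F m ⟩
  ∑Split splitMonomial m (λ a b → (G a + K a) * F b)
    ≡⟨ ∑Split-cong splitMonomial m (λ a b → ℚ.*-distribʳ-+ (F b) (G a) (K a)) ⟩
  ∑Split splitMonomial m (λ a b → G a * F b + K a * F b)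
    ≡⟨ ∑Split-+ splitMonomial m _ _ ⟩
  ∑Split splitMonomial m (λ a b → G a * F b) + ∑Split splitMonomial m (λ a b → K a * F b)
    ≡⟨ cong₂ _+_ (∙-∑Split G F m) (∙-∑Split K F m) ⟨
  ((G ∙ F) ⊞ (K ∙ F)) m ∎
  where open ≡-Reasoning

∙-zeroˡ : ∀ F → 𝟘 ∙ F ≈ 𝟘
∙-zeroˡ F m = trans (∙-∑Split 𝟘 F m) (trans
  (∑Split-cong splitMonomial m λ a b → ℚ.*-zeroˡ (F b)) (∑Split-0 splitMonomial m))

seriesRing : CommutativeRing 0ℓ 0ℓ
seriesRing = record
  { Carrier = Series ; _≈_ = _≈_ ; _+_ = _⊞_ ; _*_ = _∙_ ; -_ = ⊟_ ; 0# = 𝟘 ; 1# = 𝟙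
  ; isCommutativeRing = record
    { isRing = record
      { +-isAbelianGroup = record
        { isGroup = record
          { isMonoid = +-isMonoid
          ; inverse  = (λ F m → ℚ.+-inverseˡ (F m)) , (λ F m → ℚ.+-inverseʳ (F m))
          ; ⁻¹-cong  = λ eq m → cong -_ (eq m)
          }
        ; comm = ⊞-comm
        }
      ; *-cong     = S.*-cong
      ; *-assoc    = S.*-assoc
      ; *-identity = S.*-identity
      ; distrib    = S.distrib
      }
    ; *-comm = ∙-comm
    }
  }
  where
  isEquivalence : IsEquivalence _≈_
  isEquivalence = record
    { refl = λ _ → refl ; sym = λ eq m → sym (eq m) ; trans = λ eq eq′ m → trans (eq m) (eq′ m) }

  +-isMonoid : IsMonoid _≈_ _⊞_ 𝟘
  +-isMonoid = record
    { isSemigroup = record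
      { isMagma = record { isEquivalence = isEquivalence ; ∙-cong = λ eq eq′ m → cong₂ _+_ (eq m) (eq′ m) }
      ; assoc   = λ F G K m → ℚ.+-assoc (F m) (G m) (K m)
      }
    ; identity = (λ F m → ℚ.+-identityˡ (F m)) , (λ F m → ℚ.+-identityʳ (F m))
    }

  ⊞-comm : ∀ F G → F ⊞ G ≈ G ⊞ F
  ⊞-comm F G m = ℚ.+-comm (F m) (G m)

  isCommutativeSemiring : IsCommutativeSemiring _≈_ _⊞_ _∙_ 𝟘 𝟙
  isCommutativeSemiring = isCommutativeSemiringˡ record
    { +-isCommutativeMonoid = record { isMonoid = +-isMonoid ; comm = ⊞-comm }
    ; *-isCommutativeMonoid = record
      { isMonoid = record
        { isSemigroup = record
          { isMagma = record { isEquivalence = isEquivalence ; ∙-cong = ∙-cong }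
          ; assoc   = ∙-assoc
          }
        ; identity = ∙-identityˡ , λ F m → trans (∙-comm F 𝟙 m) (∙-identityˡ F m)
        }
      ; comm = ∙-comm
      }
    ; distribʳ = ∙-distribʳ
    ; zeroˡ    = ∙-zeroˡ
    }

  module S = IsCommutativeSemiring isCommutativeSemiring

module 𝕊 = CommutativeRing seriesRing
module 𝕊∑ = Sums 𝕊.commutativeSemiring

⨁-at : ∀ {A : Set} (xs : List A) (F : A → Series) m → 𝕊∑.⨁ xs F m ≡ ∑ xs (λ x → F x m)
⨁-at []       F m = refl
⨁-at (x ∷ xs) F m = cong (F x m +_) (⨁-at xs F m)

-- The substitution of r-th powers as a ring homomorphism

module _ (r : ℕ) .{{_ : NonZero r}} where
  open ≡-Reasoning
  private
    χ : Monomial → ℚ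
    χ = ∏ (∏ (λ e → 𝕀 (r ∣? e)))

    quot : Monomial → Monomial
    quot = map (map (ℕ._/ r))

  substPower-∏ : ∀ F m → substPower r F m ≡ χ m * F (quot m)
  substPower-∏ F m = trans (if-𝕀 (all? (all? (r ∣?_)) m) _) (cong (_* F (quot m))
    (trans (𝕀-all (all? (r ∣?_)) m) (∏-cong (𝕀-all (r ∣?_)) m)))

  substPower-cong : ∀ {F G} → F ≈ G → substPower r F ≈ substPower r G
  substPower-cong {F} {G} F≈G m = trans (substPower-∏ F m)
    (trans (cong (χ m *_) (F≈G (quot m))) (sym (substPower-∏ G m)))

  substPower-⨁ : ∀ {A : Set} (xs : List A) F → substPower r (𝕊∑.⨁ xs F) ≈ 𝕊∑.⨁ xs (λ x → substPower r (F x))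
  substPower-⨁ xs F m = begin
    substPower r (𝕊∑.⨁ xs F) m                 ≡⟨ substPower-∏ (𝕊∑.⨁ xs F) m ⟩
    χ m * 𝕊∑.⨁ xs F (quot m)                   ≡⟨ cong (χ m *_) (⨁-at xs F (quot m)) ⟩
    χ m * ∑ xs (λ x → F x (quot m))            ≡⟨ ⨁-*ˡ xs (χ m) _ ⟨
    ∑ xs (λ x → χ m * F x (quot m))            ≡⟨ ⨁-cong xs (λ x → substPower-∏ (F x) m) ⟨
    ∑ xs (λ x → substPower r (F x) m)          ≡⟨ ⨁-at xs (λ x → substPower r (F x)) m ⟨
    𝕊∑.⨁ xs (λ x → substPower r (F x)) m       ∎

  substPower-𝟘 : substPower r 𝟘 ≈ 𝟘
  substPower-𝟘 m = trans (substPower-∏ 𝟘 m) (ℚ.*-zeroʳ (χ m))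

substPower-∙ : ∀ r .{{_ : NonZero r}} F G → substPower r (F ∙ G) ≈ substPower r F ∙ substPower r G
substPower-∙ r@(suc r-1) F G m = sym (begin
  (substPower r F ∙ substPower r G) m
    ≡⟨ ∙-∑Split (substPower r F) (substPower r G) m ⟩
  ∑Split splitMonomial m (λ a b → substPower r F a * substPower r G b)
    ≡⟨ ∑Split-cong splitMonomial m (λ a b → trans (cong₂ _*_ (substPower-∏ r F a) (substPower-∏ r G b))
         (ℚ*.interchange (χ a) (F (quot a)) (χ b) (G (quot b)))) ⟩
  ∑Split splitMonomial m (λ a b → (χ a * χ b) * (F (quot a) * G (quot b)))
    ≡⟨ splitWith-rescaling _ _ _ (splitWith-rescaling _ _ _ (splitℕ-rescaling r-1)) m (λ a b → F a * G b) ⟩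
  χ m * ∑Split splitMonomial (quot m) (λ a b → F a * G b)
    ≡⟨ cong (χ m *_) (∙-∑Split F G (quot m)) ⟨
  χ m * (F ∙ G) (quot m)
    ≡⟨ substPower-∏ r (F ∙ G) m ⟨
  substPower r (F ∙ G) m ∎)
  where
  open ≡-Reasoning
  χ : Monomial → ℚ
  χ = ∏ (∏ (λ e → 𝕀 (r ∣? e)))
  quot : Monomial → Monomial
  quot = map (map (ℕ._/ r))

substPower-𝟙 : ∀ r .{{_ : NonZero r}} → substPower r 𝟙 ≈ 𝟙
substPower-𝟙 r m = begin
  substPower r 𝟙 m
    ≡⟨ trans (substPower-∏ r 𝟙 m) (cong (∏ (∏ (λ e → 𝕀 (r ∣? e))) m *_) (𝟙-∏ (map (map (ℕ._/ r)) m))) ⟩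
  ∏ (∏ (λ e → 𝕀 (r ∣? e))) m * isOne (map (map (ℕ._/ r)) m)
    ≡⟨ ∏-rescale (∏ (λ e → 𝕀 (r ∣? e))) (map (ℕ._/ r)) _ (∏-rescale (λ e → 𝕀 (r ∣? e)) (ℕ._/ r) _ single) m ⟩
  isOne m
    ≡⟨ 𝟙-∏ m ⟨
  𝟙 m ∎
  where
  open ≡-Reasoning
  ∏-rescale : ∀ {A : Set} (χ : A → ℚ) (q : A → A) ε → (∀ x → χ x * ε (q x) ≡ ε x) →
              ∀ xs → ∏ χ xs * ∏ ε (map q xs) ≡ ∏ ε xs
  ∏-rescale χ q ε eq []       = refl
  ∏-rescale χ q ε eq (x ∷ xs) = trans (ℚ*.interchange (χ x) (∏ χ xs) (ε (q x)) (∏ ε (map q xs)))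
    (cong₂ _*_ (eq x) (∏-rescale χ q ε eq xs))

  single : ∀ e → 𝕀 (r ∣? e) * 𝕀 (e ℕ./ r ℕ.≟ 0) ≡ 𝕀 (e ℕ.≟ 0)
  single e = trans (sym (𝕀-× (r ∣? e) (e ℕ./ r ℕ.≟ 0))) (𝕀-⇔ (r ∣? e ×-dec e ℕ./ r ℕ.≟ 0) (e ℕ.≟ 0)
    (λ (r∣e , e/r≡0) → trans (sym (ℕ.m/n*n≡m r∣e)) (cong (ℕ._* r) e/r≡0))
    (λ { refl → r ∣0 , ℕ.0/n≡0 r }))

-- The relation between H and E

degreeFrom-additive : ∀ i m → AdditiveAt (degreeFrom i) splitMonomial m
degreeFrom-additive i []        = splitWith-additive-[] _ (degreeFrom i) refl
degreeFrom-additive i (row ∷ m) = splitWith-additive-∷ _ (λ row → i ℕ.* sum row) (degreeFrom i) (degreeFrom (suc i))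
  (λ _ _ → refl) row-additive (degreeFrom-additive (suc i) m)
  where
  sum-additive : ∀ row → AdditiveAt sum (splitWith splitℕ) row
  sum-additive []        = splitWith-additive-[] _ sum refl
  sum-additive (e ∷ row) =
    splitWith-additive-∷ _ (λ e → e) sum sum (λ _ _ → refl) (splitℕ-additive e) (sum-additive row)

  row-additive : AdditiveAt (λ row → i ℕ.* sum row) (splitWith splitℕ) row
  row-additive Φ = trans
    (∑Split-cong _ row λ a b → cong (Φ a b) (sym (ℕ.*-distribˡ-+ i (sum a) (sum b))))
    (sum-additive row (λ a b s → Φ a b (i ℕ.* s)))

signᴹ : Monomial → ℚ
signᴹ = ∏ (∏ sign)

-- Being square-free and counting indeterminates are both local conditions, so the signed indicator
-- factors over the exponents. This brings E within reach of `splitWith-convolve`.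
signᴹ-squareFree : ∀ m → 𝕀 (squareFree? m) * (- 1ℚ) ^ indeterminates m ≡ signᴹ m
signᴹ-squareFree []        = refl
signᴹ-squareFree (row ∷ m) = begin
  𝕀 (squareFree? (row ∷ m)) * (- 1ℚ) ^ support (row ++ concat m)
    ≡⟨ cong₂ _*_ (𝕀-⇔ (squareFree? (row ∷ m)) (all? (ℕ._≤? 1) row ×-dec squareFree? m) All.uncons (uncurry _∷_))
                 (cong ((- 1ℚ) ^_) (support-++ row (concat m))) ⟩
  𝕀 (all? (ℕ._≤? 1) row ×-dec squareFree? m) * (- 1ℚ) ^ (support row ℕ.+ indeterminates m)
    ≡⟨ cong₂ _*_ (𝕀-× (all? (ℕ._≤? 1) row) (squareFree? m)) (^-homo-* (- 1ℚ) (support row) (indeterminates m)) ⟩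
  (𝕀 (all? (ℕ._≤? 1) row) * 𝕀 (squareFree? m)) * ((- 1ℚ) ^ support row * (- 1ℚ) ^ indeterminates m)
    ≡⟨ ℚ*.interchange (𝕀 (all? (ℕ._≤? 1) row)) (𝕀 (squareFree? m)) ((- 1ℚ) ^ support row) _ ⟩
  (𝕀 (all? (ℕ._≤? 1) row) * (- 1ℚ) ^ support row) * (𝕀 (squareFree? m) * (- 1ℚ) ^ indeterminates m)
    ≡⟨ cong₂ _*_ (on-row row) (signᴹ-squareFree m) ⟩
  signᴹ (row ∷ m) ∎
  where
  open ≡-Reasoning
  support : List ℕ → ℕ
  support = length ∘ filter (0 ℕ.<?_)

  support-++ : ∀ xs ys → support (xs ++ ys) ≡ support xs ℕ.+ support ys
  support-++ xs ys = trans (cong length (filter-++ (0 ℕ.<?_) xs ys)) (length-++ (filter (0 ℕ.<?_) xs))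

  single : ∀ e → 𝕀 (e ℕ.≤? 1) * (- 1ℚ) ^ support (e ∷ []) ≡ sign e
  single 0             = refl
  single 1             = refl
  single (suc (suc e)) = ℚ.*-zeroˡ ((- 1ℚ) ^ support (suc (suc e) ∷ []))

  on-row : ∀ row → 𝕀 (all? (ℕ._≤? 1) row) * (- 1ℚ) ^ support row ≡ ∏ sign row
  on-row []        = refl
  on-row (e ∷ row) = begin
    𝕀 (all? (ℕ._≤? 1) (e ∷ row)) * (- 1ℚ) ^ support (e ∷ row)
      ≡⟨ cong₂ _*_ (𝕀-⇔ (all? (ℕ._≤? 1) (e ∷ row)) (e ℕ.≤? 1 ×-dec all? (ℕ._≤? 1) row) All.uncons (uncurry _∷_))
                   (cong ((- 1ℚ) ^_) (support-++ (e ∷ []) row)) ⟩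
    𝕀 (e ℕ.≤? 1 ×-dec all? (ℕ._≤? 1) row) * (- 1ℚ) ^ (support (e ∷ []) ℕ.+ support row)
      ≡⟨ cong₂ _*_ (𝕀-× (e ℕ.≤? 1) (all? (ℕ._≤? 1) row)) (^-homo-* (- 1ℚ) (support (e ∷ [])) (support row)) ⟩
    (𝕀 (e ℕ.≤? 1) * 𝕀 (all? (ℕ._≤? 1) row)) * ((- 1ℚ) ^ support (e ∷ []) * (- 1ℚ) ^ support row)
      ≡⟨ ℚ*.interchange (𝕀 (e ℕ.≤? 1)) _ ((- 1ℚ) ^ support (e ∷ [])) _ ⟩
    (𝕀 (e ℕ.≤? 1) * (- 1ℚ) ^ support (e ∷ [])) * (𝕀 (all? (ℕ._≤? 1) row) * (- 1ℚ) ^ support row)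
      ≡⟨ cong₂ _*_ (single e) (on-row row) ⟩
    ∏ sign (e ∷ row) ∎

Edeg-∏ : ∀ d m → Edeg d m ≡ signᴹ m * 𝕀 (degree m ℕ.≟ d)
Edeg-∏ d m = begin
  Edeg d m
    ≡⟨ if-𝕀 (squareFree? m ×-dec degree m ℕ.≟ d) _ ⟩
  𝕀 (squareFree? m ×-dec degree m ℕ.≟ d) * (- 1ℚ) ^ indeterminates m
    ≡⟨ cong (_* (- 1ℚ) ^ indeterminates m) (trans (𝕀-× (squareFree? m) (degree m ℕ.≟ d))
         (ℚ.*-comm (𝕀 (squareFree? m)) (𝕀 (degree m ℕ.≟ d)))) ⟩
  (𝕀 (degree m ℕ.≟ d) * 𝕀 (squareFree? m)) * (- 1ℚ) ^ indeterminates m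
    ≡⟨ ℚ.*-assoc (𝕀 (degree m ℕ.≟ d)) _ _ ⟩
  𝕀 (degree m ℕ.≟ d) * (𝕀 (squareFree? m) * (- 1ℚ) ^ indeterminates m)
    ≡⟨ trans (cong (𝕀 (degree m ℕ.≟ d) *_) (signᴹ-squareFree m)) (ℚ.*-comm _ (signᴹ m)) ⟩
  signᴹ m * 𝕀 (degree m ℕ.≟ d) ∎
  where open ≡-Reasoning

isOne-degree : ∀ m → isOne m ≡ 𝕀 (degree m ℕ.≟ 0)
isOne-degree = from 0
  where
  open ≡-Reasoning
  row-sum : ∀ row → ∏ (λ e → 𝕀 (e ℕ.≟ 0)) row ≡ 𝕀 (sum row ℕ.≟ 0)
  row-sum []            = refl
  row-sum (zero  ∷ row) = trans (ℚ.*-identityˡ _) (row-sum row)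
  row-sum (suc e ∷ row) = ℚ.*-zeroˡ (∏ (λ e → 𝕀 (e ℕ.≟ 0)) row)

  -- The generalised index is `suc i`, since a row of index 0 would have degree 0 whatever its
  -- exponents.
  from : ∀ i m → isOne m ≡ 𝕀 (degreeFrom (suc i) m ℕ.≟ 0)
  from i []        = refl
  from i (row ∷ m) = begin
    isOne (row ∷ m)
      ≡⟨ cong₂ _*_ (row-sum row) (from (suc i) m) ⟩
    𝕀 (sum row ℕ.≟ 0) * 𝕀 (degreeFrom (2 ℕ.+ i) m ℕ.≟ 0)
      ≡⟨ 𝕀-× (sum row ℕ.≟ 0) (degreeFrom (2 ℕ.+ i) m ℕ.≟ 0) ⟨
    𝕀 (sum row ℕ.≟ 0 ×-dec degreeFrom (2 ℕ.+ i) m ℕ.≟ 0)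
      ≡⟨ 𝕀-⇔ (sum row ℕ.≟ 0 ×-dec degreeFrom (2 ℕ.+ i) m ℕ.≟ 0) (degreeFrom (suc i) (row ∷ m) ℕ.≟ 0)
           (λ (s≡0 , d≡0) → cong₂ ℕ._+_ (trans (cong (suc i ℕ.*_) s≡0) (ℕ.*-zeroʳ (suc i))) d≡0)
           (λ d≡0 → ℕ.m+n≡0⇒m≡0 (sum row) (ℕ.m+n≡0⇒m≡0 (suc i ℕ.* sum row) d≡0) ,
                    ℕ.m+n≡0⇒n≡0 (suc i ℕ.* sum row) d≡0) ⟩
    𝕀 (degreeFrom (suc i) (row ∷ m) ℕ.≟ 0) ∎

Hdeg-0 : Hdeg 0 ≈ 𝟙
Hdeg-0 m = sym (trans (𝟙-∏ m) (isOne-degree m))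

Edeg-0 : Edeg 0 ≈ 𝟙
Edeg-0 m = begin
  Edeg 0 m                             ≡⟨ Edeg-∏ 0 m ⟩
  signᴹ m * 𝕀 (degree m ℕ.≟ 0)         ≡⟨ cong (signᴹ m *_) (isOne-degree m) ⟨
  signᴹ m * isOne m                    ≡⟨ ∏-* (∏ sign) _ m ⟨
  ∏ (λ row → ∏ sign row * ∏ (λ e → 𝕀 (e ℕ.≟ 0)) row) m
                                       ≡⟨ ∏-cong (λ row → trans (sym (∏-* sign _ row)) (∏-cong single row)) m ⟩
  isOne m                              ≡⟨ 𝟙-∏ m ⟨
  𝟙 m                                  ∎
  where
  open ≡-Reasoning
  single : ∀ e → sign e * 𝕀 (e ℕ.≟ 0) ≡ 𝕀 (e ℕ.≟ 0)
  single zero    = refl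
  single (suc e) = ℚ.*-zeroʳ (sign (suc e))

-- The product of all 1/(1 - x) with all 1 - x is 1, read off in degree `suc d`. Once the degree
-- conditions collapse to one on `m`, the sum of `signᴹ b` over the splittings is `isOne m`, which
-- lives in degree 0 only.
Hdeg∙Edeg : ∀ d → 𝕊∑.⨁ (splitℕ (suc d)) (λ (k , l) → Hdeg k ∙ Edeg l) ≈ 𝟘
Hdeg∙Edeg d m = begin
  𝕊∑.⨁ (splitℕ (suc d)) (λ (k , l) → Hdeg k ∙ Edeg l) m
    ≡⟨ ⨁-at (splitℕ (suc d)) (λ (k , l) → Hdeg k ∙ Edeg l) m ⟩
  ∑ (splitℕ (suc d)) (λ (k , l) → (Hdeg k ∙ Edeg l) m)
    ≡⟨ ∑Split-def splitℕ (suc d) (λ k l → (Hdeg k ∙ Edeg l) m) ⟨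
  ∑Split splitℕ (suc d) (λ k l → (Hdeg k ∙ Edeg l) m)
    ≡⟨ ∑Split-cong splitℕ (suc d) (λ k l → trans (∙-∑Split (Hdeg k) (Edeg l) m)
         (∑Split-cong splitMonomial m λ a b → trans (cong (Hdeg k a *_) (Edeg-∏ l b))
           (ℚ*.x∙yz≈y∙xz (Hdeg k a) (signᴹ b) _))) ⟩
  ∑Split splitℕ (suc d) (λ k l → ∑Split splitMonomial m λ a b →
    signᴹ b * (𝕀 (degree a ℕ.≟ k) * 𝕀 (degree b ℕ.≟ l)))
    ≡⟨ ∑Split-swap splitℕ splitMonomial (suc d) m _ ⟩
  ∑Split splitMonomial m (λ a b → ∑Split splitℕ (suc d) λ k l →
    signᴹ b * (𝕀 (degree a ℕ.≟ k) * 𝕀 (degree b ℕ.≟ l)))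
    ≡⟨ ∑Split-cong splitMonomial m (λ a b → trans (∑Split-*ˡ splitℕ (suc d) (signᴹ b) _)
         (cong (signᴹ b *_) (∑ℕ-𝕀 (suc d) (degree a) (degree b)))) ⟩
  ∑Split splitMonomial m (λ a b → signᴹ b * 𝕀 (degree a ℕ.+ degree b ℕ.≟ suc d))
    ≡⟨ degreeFrom-additive 1 m (λ a b s → signᴹ b * 𝕀 (s ℕ.≟ suc d)) ⟩
  ∑Split splitMonomial m (λ a b → signᴹ b * 𝕀 (degree m ℕ.≟ suc d))
    ≡⟨ trans (∑Split-cong splitMonomial m λ a b → ℚ.*-comm (signᴹ b) _)
         (∑Split-*ˡ splitMonomial m (𝕀 (degree m ℕ.≟ suc d)) (λ _ → signᴹ)) ⟩
  𝕀 (degree m ℕ.≟ suc d) * ∑Split splitMonomial m (λ a b → signᴹ b)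
    -- A factor 1, written as a product of ones over the exponents of `a`, is inserted: it is the
    -- coefficient of 1/(1 - x) that `splitWith-convolve` pairs with `sign`.
    ≡⟨ cong (𝕀 (degree m ℕ.≟ suc d) *_) (trans (∑Split-cong splitMonomial m λ a b →
         trans (sym (ℚ.*-identityˡ (signᴹ b))) (cong (_* signᴹ b) (sym (trans (∏-cong ∏-1 a) (∏-1 a)))))
         (splitWith-convolve _ _ _ _ (splitWith-convolve _ _ _ _ splitℕ-sign) m)) ⟩
  𝕀 (degree m ℕ.≟ suc d) * isOne m
    ≡⟨ cong (𝕀 (degree m ℕ.≟ suc d) *_) (isOne-degree m) ⟩
  𝕀 (degree m ℕ.≟ suc d) * 𝕀 (degree m ℕ.≟ 0)
    ≡⟨ incompatible (degree m) ⟩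
  0ℚ ∎
  where
  open ≡-Reasoning
  incompatible : ∀ k → 𝕀 (k ℕ.≟ suc d) * 𝕀 (k ℕ.≟ 0) ≡ 0ℚ
  incompatible zero    = refl
  incompatible (suc k) = ℚ.*-zeroʳ (𝕀 (suc k ℕ.≟ suc d))

Edeg∙Hdeg : ∀ d → 𝕊∑.⨁ (splitℕ (suc d)) (λ (k , l) → Edeg k ∙ Hdeg l) ≈ 𝟘
Edeg∙Hdeg d m = begin
  𝕊∑.⨁ (splitℕ (suc d)) (λ (k , l) → Edeg k ∙ Hdeg l) m
    ≡⟨ ⨁-at (splitℕ (suc d)) (λ (k , l) → Edeg k ∙ Hdeg l) m ⟩
  ∑ (splitℕ (suc d)) (λ (k , l) → (Edeg k ∙ Hdeg l) m)
    ≡⟨ ∑Split-def splitℕ (suc d) (λ k l → (Edeg k ∙ Hdeg l) m) ⟨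
  ∑Split splitℕ (suc d) (λ k l → (Edeg k ∙ Hdeg l) m)
    ≡⟨ splitℕ-cocommutative (suc d) _ ⟩
  ∑Split splitℕ (suc d) (λ k l → (Edeg l ∙ Hdeg k) m)
    ≡⟨ ∑Split-cong splitℕ (suc d) (λ k l → ∙-comm (Edeg l) (Hdeg k) m) ⟩
  ∑Split splitℕ (suc d) (λ k l → (Hdeg k ∙ Edeg l) m)
    ≡⟨ ∑Split-def splitℕ (suc d) (λ k l → (Hdeg k ∙ Edeg l) m) ⟩
  ∑ (splitℕ (suc d)) (λ (k , l) → (Hdeg k ∙ Edeg l) m)
    ≡⟨ ⨁-at (splitℕ (suc d)) (λ (k , l) → Hdeg k ∙ Edeg l) m ⟨
  𝕊∑.⨁ (splitℕ (suc d)) (λ (k , l) → Hdeg k ∙ Edeg l) m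
    ≡⟨ Hdeg∙Edeg d m ⟩
  0ℚ ∎
  where open ≡-Reasoning

-- Grouping brickings by content

lengths-positive : ∀ {s e} (β : Bricks s e) → All (0 <_) (lengths β)
lengths-positive []            = []
lengths-positive (brick s<m β) = ℕ.m<n⇒0<n∸m (recompute (_ ℕ.<? _) s<m) ∷ lengths-positive β

rowLengths-positive : ∀ {ds} (T : All (Bricks 0) ds) → All (0 <_) (rowLengths T)
rowLengths-positive []      = []
rowLengths-positive (β ∷ T) = All.++⁺ (lengths-positive β) (rowLengths-positive T)

lengthsAt-positive : ∀ {k} {v : Vec Partition k} (T : Filling v) i → All (0 <_) (lengthsAt T i)
lengthsAt-positive (t ∷ T) Fin.zero    = rowLengths-positive t
lengthsAt-positive (t ∷ T) (Fin.suc i) = lengthsAt-positive T i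

sum-lengths : ∀ {s e} (β : Bricks s e) → sum (lengths β) ℕ.+ s ≡ e
sum-lengths []                        = refl
sum-lengths {s} {e} (brick {m = m} s<m β) = begin
  (m ∸ s ℕ.+ sum (lengths β)) ℕ.+ s   ≡⟨ cong (ℕ._+ s) (ℕ.+-comm (m ∸ s) _) ⟩
  (sum (lengths β) ℕ.+ (m ∸ s)) ℕ.+ s ≡⟨ ℕ.+-assoc (sum (lengths β)) (m ∸ s) s ⟩
  sum (lengths β) ℕ.+ (m ∸ s ℕ.+ s)   ≡⟨ cong (sum (lengths β) ℕ.+_) (ℕ.m∸n+n≡m (ℕ.<⇒≤ (recompute (s ℕ.<? m) s<m))) ⟩
  sum (lengths β) ℕ.+ m               ≡⟨ sum-lengths β ⟩
  e                                   ∎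
  where open ≡-Reasoning

sum-rowLengths : ∀ {ds} (T : All (Bricks 0) ds) → sum (rowLengths T) ≡ sum ds
sum-rowLengths []      = refl
sum-rowLengths (β ∷ T) = trans (sum-++ (lengths β) (rowLengths T))
  (cong₂ ℕ._+_ (trans (sym (ℕ.+-identityʳ _)) (sum-lengths β)) (sum-rowLengths T))

sum-lengthsAt : ∀ {k} {v : Vec Partition k} (T : Filling v) i → sum (lengthsAt T i) ≡ ∣ lookup v i ∣
sum-lengthsAt (t ∷ T) Fin.zero    = sum-rowLengths t
sum-lengthsAt (t ∷ T) (Fin.suc i) = sum-lengthsAt T i

sorted : (xs : List ℕ) → All (0 <_) xs → Partition
sorted xs xs>0 = sort xs , [ All-resp-↭ (↭-sym (sort-↭ xs)) xs>0 , sort-↗ xs ]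

-- Decreasing lists that are permutations of each other are equal, so a partition is determined by
-- the multiset of its parts.
sorted-↭ : ∀ {xs} xs>0 (mu : Partition) → xs ↭ parts mu → sorted xs xs>0 ≡ mu
sorted-↭ {xs} xs>0 (ys , [ p ]) xs↭ys = value-injective (Pointwise-≡⇒≡ (↗↭↗⇒≋ ≥-totalOrder (sort-↗ xs)
  (proj₂ (recompute (all? (0 ℕ.<?_) ys ×-dec linked? ℕ._≥?_ ys) p))
  (↭⇒↭ₛ′ (TotalOrder.Eq.isEquivalence ≥-totalOrder) (↭-trans (sort-↭ xs) xs↭ys))))

module _ {n : ℕ} where

  contentVec : {v : Vec Partition n} → Filling v → Vec Partition n
  contentVec T = Vec.tabulate (λ i → sorted (lengthsAt T i) (lengthsAt-positive T i))

  lengthsAt-↭-contentVec : {v : Vec Partition n} (T : Filling v) → ∀ i →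
    lengthsAt T i ↭ parts (lookup (contentVec T) i)
  lengthsAt-↭-contentVec T i = subst (λ mu → lengthsAt T i ↭ parts mu)
    (sym (Vec.lookup∘tabulate _ i)) (↭-sym (sort-↭ (lengthsAt T i)))

  -- Bricks tile their rows, so the size of each partition is kept; this is why the content of a
  -- filling is again a type of the same number.
  weight-contentVec : {v : Vec Partition n} (T : Filling v) → weight (contentVec T) ≡ weight v
  weight-contentVec T = cong sum (map-cong (λ i → cong (suc (toℕ i) ℕ.*_)
    (trans (sym (sum-↭ (lengthsAt-↭-contentVec T i))) (sum-lengthsAt T i))) (allFin n))

content : ∀ {n} (σ : Typ n) → Filling (value σ) → Typ n
content (v , [ p ]) T = contentVec T , [ trans (weight-contentVec T) p ]

forget : ∀ {k} {u v : Vec Partition k} → Pointwise BrickTabloid u v → Filling u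
forget []      = []
forget (t ∷ p) = value t ∷ forget p

lengthsAt-forget : ∀ {k} {u v : Vec Partition k} (p : Pointwise BrickTabloid u v) i →
                   lengthsAt (forget p) i ↭ parts (lookup v i)
lengthsAt-forget {v = mu ∷ v} ((T , [ q ]) ∷ p) Fin.zero    = recompute (rowLengths T ↭? parts mu) q
lengthsAt-forget              (t ∷ p)           (Fin.suc i) = lengthsAt-forget p i

-- The evidence about the content is irrelevant, so a tabloid is determined by its bricks.
forget-injective : ∀ {k} {u v : Vec Partition k} {p q : Pointwise BrickTabloid u v} →
                   forget p ≡ forget q → p ≡ q
forget-injective {p = []}    {[]}    _  = refl
forget-injective {p = t ∷ p} {w ∷ q} eq = cong₂ _∷_
  (value-injective (cong VecAll.head eq)) (forget-injective (cong VecAll.tail eq))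

forget-surjective : ∀ {k} {u : Vec Partition k} (T : Filling u) (v : Vec Partition k) →
  (∀ i → lengthsAt T i ↭ parts (lookup v i)) → ∃ λ (p : Pointwise BrickTabloid u v) → forget p ≡ T
forget-surjective []      []       T↭v = [] , refl
forget-surjective (t ∷ T) (mu ∷ v) T↭v with forget-surjective T v (T↭v ∘ Fin.suc)
... | p , refl = (t , [ T↭v Fin.zero ]) ∷ p , refl

content-forget : ∀ {n} (σ ρ : Typ n) (p : PTsimp σ ρ) → content σ (forget p) ≡ ρ
content-forget σ ρ p = value-injective (trans
  (Vec.tabulate-cong (λ i → sorted-↭ (lengthsAt-positive (forget p) i) (lookup (value ρ) i) (lengthsAt-forget p i)))
  (Vec.tabulate∘lookup (value ρ)))

module _ {n : ℕ} (σ : Typ n) where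

  withContent : Typ n → List (Filling (value σ))
  withContent ρ = map forget (elements (finitePTsimp σ ρ))

  -- Every filling has exactly one content, so the sets `PTsimp σ ρ` partition the fillings as `ρ`
  -- varies; `content σ` is the label that keeps them disjoint.
  fillings-by-content : fillings (value σ) ↭ concatMap withContent (elements (finiteTyp n))
  fillings-by-content = ∼bag⇒↭ (unique∧set⇒bag (fillings-unique (value σ)) by-content-unique
    (mk⇔ (λ _ → by-content-complete _) (λ _ → fillings-complete _)))
    where
    by-content-unique : Unique (concatMap withContent (elements (finiteTyp n)))
    by-content-unique = concatMap-unique withContent (content σ) (λ ρ → ρ) (λ eq → eq) label
      (λ ρ → Unique.map⁺ forget-injective (unique (finitePTsimp σ ρ)))
      (unique (finiteTyp n))
      where
      label : ∀ ρ {T} → T ∈ withContent ρ → content σ T ≡ ρ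
      label ρ T∈ with ∈-map⁻ forget T∈
      ... | p , _ , refl = content-forget σ ρ p

    by-content-complete : ∀ T → T ∈ concatMap withContent (elements (finiteTyp n))
    by-content-complete T = ∈-concatMap⁺ withContent
      (Any.map (λ { refl → T∈ }) (complete (finiteTyp n) (content σ T)))
      where
      T∈ : T ∈ withContent (content σ T)
      T∈ with forget-surjective T (contentVec T) (lengthsAt-↭-contentVec T)
      ... | p , forget-p≡T = subst (_∈ withContent (content σ T)) forget-p≡T
                           (∈-map⁺ forget (complete (finitePTsimp σ (content σ T)) p))

-- From sums over brickings to signed counts

-- `+ n / 1` is normalised by a gcd that does not reduce for a variable `n`, hence the passage to
-- unnormalised fractions.
ℕ/1-suc : ∀ n → ℤ.+ suc n / 1 ≡ 1ℚ + ℤ.+ n / 1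
ℕ/1-suc n = ℚ.toℚᵘ-injective (begin-equality
  toℚᵘ (ℤ.+ suc n / 1)                      ≃⟨ ℚ.toℚᵘ-fromℚᵘ (ℚᵘ.mkℚᵘ (ℤ.+ suc n) 0) ⟩
  ℚᵘ.mkℚᵘ (ℤ.+ suc n) 0
    ≃⟨ ℚᵘ.*≡* (cong (λ k → (ℤ.+ 1 ℤ.+ k) ℤ.* ℤ.+ 1) (sym (ℤ.*-identityʳ (ℤ.+ n)))) ⟩
  ℚᵘ.1ℚᵘ ℚᵘ.+ ℚᵘ.mkℚᵘ (ℤ.+ n) 0             ≃⟨ ℚᵘ.+-congʳ ℚᵘ.1ℚᵘ (ℚ.toℚᵘ-fromℚᵘ (ℚᵘ.mkℚᵘ (ℤ.+ n) 0)) ⟨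
  ℚᵘ.1ℚᵘ ℚᵘ.+ toℚᵘ (ℤ.+ n / 1)              ≃⟨ ℚ.toℚᵘ-homo-+ 1ℚ (ℤ.+ n / 1) ⟨
  toℚᵘ (1ℚ + ℤ.+ n / 1)                     ∎)
  where open ℚᵘ.≤-Reasoning

∑-const : ∀ {A : Set} (xs : List A) q → ∑ xs (λ _ → q) ≡ (ℤ.+ length xs / 1) * q
∑-const []       q = sym (ℚ.*-zeroˡ q)
∑-const (x ∷ xs) q = begin
  q + ∑ xs (λ _ → q)                ≡⟨ cong₂ _+_ (sym (ℚ.*-identityˡ q)) (∑-const xs q) ⟩
  1ℚ * q + (ℤ.+ length xs / 1) * q    ≡⟨ ℚ.*-distribʳ-+ q 1ℚ (ℤ.+ length xs / 1) ⟨
  (1ℚ + ℤ.+ length xs / 1) * q        ≡⟨ cong (_* q) (ℕ/1-suc (length xs)) ⟨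
  (ℤ.+ length (x ∷ xs) / 1) * q       ∎
  where open ≡-Reasoning

∙-scaleʳ : ∀ F q G → F ∙ (λ m → q * G m) ≈ (λ m → q * (F ∙ G) m)
∙-scaleʳ F q G m = begin
  (F ∙ (λ m → q * G m)) m                           ≡⟨ ∙-∑Split F _ m ⟩
  ∑Split splitMonomial m (λ a b → F a * (q * G b))
    ≡⟨ ∑Split-cong splitMonomial m (λ a b → ℚ*.x∙yz≈y∙xz (F a) q (G b)) ⟩
  ∑Split splitMonomial m (λ a b → q * (F a * G b))  ≡⟨ ∑Split-*ˡ splitMonomial m q _ ⟩
  q * ∑Split splitMonomial m (λ a b → F a * G b)    ≡⟨ cong (q *_) (∙-∑Split F G m) ⟨
  q * (F ∙ G) m                                     ∎
  where
  open ≡-Reasoning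
-- The origin of the sign in the theorem: one factor -1 per brick, that is, per block of the
-- content.
⨂-⊟ : ∀ {A : Set} (xs : List A) (F : A → Series) →
  𝕊∑.⨂ xs (λ x → ⊟ F x) ≈ (λ m → (- 1ℚ) ^ length xs * 𝕊∑.⨂ xs F m)
⨂-⊟ []       F m = sym (ℚ.*-identityˡ (𝟙 m))
⨂-⊟ (x ∷ xs) F m = begin
  (⊟ F x ∙ 𝕊∑.⨂ xs (λ x → ⊟ F x)) m               ≡⟨ -‿distribˡ-* (F x) (𝕊∑.⨂ xs (λ x → ⊟ F x)) m ⟨
  - (F x ∙ 𝕊∑.⨂ xs (λ x → ⊟ F x)) m               ≡⟨ cong -_ (∙-cong {F x} (λ _ → refl) (⨂-⊟ xs F) m) ⟩
  - (F x ∙ (λ m → s * 𝕊∑.⨂ xs F m)) m             ≡⟨ cong -_ (∙-scaleʳ (F x) s (𝕊∑.⨂ xs F) m) ⟩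
  - (s * (F x ∙ 𝕊∑.⨂ xs F) m)                     ≡⟨ ℚ.neg-distribˡ-* s _ ⟩
  - s * (F x ∙ 𝕊∑.⨂ xs F) m                       ≡⟨ cong (_* (F x ∙ 𝕊∑.⨂ xs F) m)
                                                       (trans (cong -_ (sym (ℚ.*-identityˡ s))) (ℚ.neg-distribˡ-* 1ℚ s)) ⟩
  (- 1ℚ * s) * (F x ∙ 𝕊∑.⨂ xs F) m                ∎
  where
  open ≡-Reasoning
  open RingProperties 𝕊.ring using (-‿distribˡ-*)
  s : ℚ
  s = (- 1ℚ) ^ length xs

⨂-blocks : ∀ {n} (τ : Typ n) (f : Fin n → ℕ → Series) →
  𝕊∑.⨂ (blocks τ) (λ (d , i) → f i d) ≈ 𝕊∑.⨂ (allFin n) (λ i → 𝕊∑.⨂ (parts (lookup (value τ) i)) (f i))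
⨂-blocks {n} τ f = 𝕊.trans (𝕊∑.⨂-concatMap _ (allFin n) (λ (d , i) → f i d))
  (𝕊∑.⨂-cong (allFin n) λ i → 𝕊.reflexive (𝕊∑.⨂-map (_, i) (parts (lookup (value τ) i)) (λ (d , i) → f i d)))

length-blocks : ∀ {n} (τ : Typ n) → length (blocks τ) ≡ ℓ τ
length-blocks {n} τ = go (allFin n)
  where
  go : ∀ is → length (concatMap (λ i → map (_, i) (parts (lookup (value τ) i))) is) ≡
              sum (map (λ i → length (parts (lookup (value τ) i))) is)
  go []       = refl
  go (i ∷ is) = trans (length-++ (map (_, i) (parts (lookup (value τ) i))))
    (cong₂ ℕ._+_ (length-map (_, i) (parts (lookup (value τ) i))) (go is))

blockFactor : (ℕ → Series) → ∀ {n} → Fin n → ℕ → Series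
blockFactor F i d = substPower (suc (toℕ i)) (F d)

blockProduct-⨂ : ∀ F {n} (τ : Typ n) → blockProduct F τ ≡ 𝕊∑.⨂ (blocks τ) (λ (d , i) → blockFactor F i d)
blockProduct-⨂ F τ = 𝕊∑.⨂-map _ (blocks τ) (λ G → G)

module _ {X Y : ℕ → Series} (X0 : X 0 ≈ 𝟙) (Y0 : Y 0 ≈ 𝟙)
         (conv : ∀ d → 𝕊∑.⨁ (splitℕ (suc d)) (λ (k , l) → Y k ∙ X l) ≈ 𝟘) {n : ℕ} (σ : Typ n) where

  private
    ⊟Y : Fin n → ℕ → Series
    ⊟Y i d = ⊟ blockFactor Y i d

    fillingWeight : Filling (value σ) → Series
    fillingWeight T = 𝕊∑.⨂ (allFin n) λ i → 𝕊∑.⨂ (lengthsAt T i) (⊟Y i)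

    firstBrick : ∀ i → FirstBrick seriesRing (blockFactor X {n} i) (⊟Y i)
    firstBrick i = convolution⇒firstBrick seriesRing (blockFactor Y i) (blockFactor X i)
      (power-𝟙 Y0) (power-𝟙 X0) λ d → begin
        𝕊∑.⨁ (splitℕ (suc d)) (λ (k , l) → blockFactor Y i k ∙ blockFactor X i l)
          ≈⟨ 𝕊∑.⨁-cong (splitℕ (suc d)) (λ (k , l) → substPower-∙ r (Y k) (X l)) ⟨
        𝕊∑.⨁ (splitℕ (suc d)) (λ (k , l) → substPower r (Y k ∙ X l))
          ≈⟨ substPower-⨁ r (splitℕ (suc d)) (λ (k , l) → Y k ∙ X l) ⟨
        substPower r (𝕊∑.⨁ (splitℕ (suc d)) (λ (k , l) → Y k ∙ X l))
          ≈⟨ substPower-cong r (conv d) ⟩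
        substPower r 𝟘
          ≈⟨ substPower-𝟘 r ⟩
        𝟘 ∎
      where
      open SetoidReasoning 𝕊.setoid
      r : ℕ
      r = suc (toℕ i)
      power-𝟙 : ∀ {F} → F ≈ 𝟙 → substPower r F ≈ 𝟙
      power-𝟙 F≈𝟙 = 𝕊.trans (substPower-cong r F≈𝟙) (substPower-𝟙 r)

    fillingWeight-forget : ∀ ρ (p : PTsimp σ ρ) m →
      fillingWeight (forget p) m ≡ (- 1ℚ) ^ ℓ ρ * blockProduct Y ρ m
    fillingWeight-forget ρ p m = begin
      fillingWeight (forget p) m
        ≡⟨ 𝕊∑.⨂-cong (allFin n) (λ i → 𝕊∑.⨂-↭ (⊟Y i) (lengthsAt-forget p i)) m ⟩
      𝕊∑.⨂ (allFin n) (λ i → 𝕊∑.⨂ (parts (lookup (value ρ) i)) (⊟Y i)) m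
        ≡⟨ ⨂-blocks ρ ⊟Y m ⟨
      𝕊∑.⨂ (blocks ρ) (λ (d , i) → ⊟Y i d) m
        ≡⟨ ⨂-⊟ (blocks ρ) (λ (d , i) → blockFactor Y i d) m ⟩
      (- 1ℚ) ^ length (blocks ρ) * 𝕊∑.⨂ (blocks ρ) (λ (d , i) → blockFactor Y i d) m
        ≡⟨ cong₂ (λ k F → (- 1ℚ) ^ k * F m) (length-blocks ρ) (sym (blockProduct-⨂ Y ρ)) ⟩
      (- 1ℚ) ^ ℓ ρ * blockProduct Y ρ m ∎
      where open ≡-Reasoning

  -- `X` and `Y` enter only through their values at 0 and the convolution relation, so exchanging H
  -- and E yields both halves of the theorem.
  blockProduct-expansion : blockProduct X σ ≈ linearCombination (signedCount σ) (blockProduct Y)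
  blockProduct-expansion m = begin
    blockProduct X σ m
      ≡⟨ cong (λ F → F m) (blockProduct-⨂ X σ) ⟩
    𝕊∑.⨂ (blocks σ) (λ (d , i) → blockFactor X i d) m
      ≡⟨ ⨂-blocks σ (blockFactor X) m ⟩
    𝕊∑.⨂ (allFin n) (λ i → 𝕊∑.⨂ (parts (lookup (value σ) i)) (blockFactor X i)) m
      ≡⟨ fillings-expansion seriesRing firstBrick (value σ) m ⟩
    𝕊∑.⨁ (fillings (value σ)) fillingWeight m
      ≡⟨ ⨁-at (fillings (value σ)) fillingWeight m ⟩
    ∑ (fillings (value σ)) (λ T → fillingWeight T m)
      ≡⟨ ⨁-↭ (λ T → fillingWeight T m) (fillings-by-content σ) ⟩
    ∑ (concatMap (withContent σ) (elements (finiteTyp n))) (λ T → fillingWeight T m)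
      ≡⟨ ⨁-concatMap (withContent σ) (elements (finiteTyp n)) (λ T → fillingWeight T m) ⟩
    ∑ (elements (finiteTyp n)) (λ ρ → ∑ (withContent σ ρ) (λ T → fillingWeight T m))
      ≡⟨ ⨁-cong (elements (finiteTyp n)) term ⟩
    linearCombination (signedCount σ) (blockProduct Y) m ∎
    where
    open ≡-Reasoning
    term : ∀ ρ → ∑ (withContent σ ρ) (λ T → fillingWeight T m) ≡ signedCount σ ρ * blockProduct Y ρ m
    term ρ = begin
      ∑ (withContent σ ρ) (λ T → fillingWeight T m)
        ≡⟨ ⨁-map forget (elements (finitePTsimp σ ρ)) (λ T → fillingWeight T m) ⟩
      ∑ (elements (finitePTsimp σ ρ)) (λ p → fillingWeight (forget p) m)
        ≡⟨ ⨁-cong (elements (finitePTsimp σ ρ)) (λ p → fillingWeight-forget ρ p m) ⟩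
      ∑ (elements (finitePTsimp σ ρ)) (λ _ → (- 1ℚ) ^ ℓ ρ * blockProduct Y ρ m)
        ≡⟨ ∑-const (elements (finitePTsimp σ ρ)) _ ⟩
      c * ((- 1ℚ) ^ ℓ ρ * blockProduct Y ρ m)
        ≡⟨ ℚ.*-assoc c ((- 1ℚ) ^ ℓ ρ) _ ⟨
      (c * (- 1ℚ) ^ ℓ ρ) * blockProduct Y ρ m
        ≡⟨ cong (_* blockProduct Y ρ m) (ℚ.*-comm c ((- 1ℚ) ^ ℓ ρ)) ⟩
      signedCount σ ρ * blockProduct Y ρ m ∎
      where
      c : ℚ
      c = ℤ.+ ∣PTsimp∣ σ ρ / 1

-- The differences of the two coefficient families combine the basis to 0, so independence forces
-- each of them to vanish.
coefficient-unique : ∀ {n} {B : Typ n → Series} (basis : IsBasis n B) {F} (F∈ : PSym n F) (c : Typ n → ℚ) →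
  F ≈ linearCombination c B → ∀ τ → IsBasis.coefficient basis F∈ τ ≡ c τ
coefficient-unique {n} {B} basis {F} F∈ c F≈c τ = x∙y⁻¹≈ε⇒x≈y _ _ (independent (λ ρ → coeff ρ + - c ρ) vanishes τ)
  where
  open IsBasis basis using (independent; expansion)
  open GroupProperties ℚR.+-group using (x∙y⁻¹≈ε⇒x≈y)
  open ≡-Reasoning
  coeff : Typ n → ℚ
  coeff = IsBasis.coefficient basis F∈
  typs : List (Typ n)
  typs = elements (finiteTyp n)
  vanishes : linearCombination (λ ρ → coeff ρ + - c ρ) B ≈ (λ _ → 0ℚ)
  vanishes m = begin
    ∑ typs (λ ρ → (coeff ρ + - c ρ) * B ρ m)
      ≡⟨ ⨁-cong typs (λ ρ → ℚ.*-distribʳ-+ (B ρ m) (coeff ρ) (- c ρ)) ⟩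
    ∑ typs (λ ρ → coeff ρ * B ρ m + - c ρ * B ρ m)
      ≡⟨ ⨁-+ typs (λ ρ → coeff ρ * B ρ m) (λ ρ → - c ρ * B ρ m) ⟩
    ∑ typs (λ ρ → coeff ρ * B ρ m) + ∑ typs (λ ρ → - c ρ * B ρ m)
      ≡⟨ cong (_+ ∑ typs (λ ρ → - c ρ * B ρ m)) (trans (sym (expansion F∈ m)) (F≈c m)) ⟩
    ∑ typs (λ ρ → c ρ * B ρ m) + ∑ typs (λ ρ → - c ρ * B ρ m)
      ≡⟨ ⨁-+ typs (λ ρ → c ρ * B ρ m) (λ ρ → - c ρ * B ρ m) ⟨
    ∑ typs (λ ρ → c ρ * B ρ m + - c ρ * B ρ m)
      ≡⟨ ⨁-cong typs (λ ρ → trans (sym (ℚ.*-distribʳ-+ (B ρ m) (c ρ) (- c ρ)))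
           (trans (cong (_* B ρ m) (ℚ.+-inverseʳ (c ρ))) (ℚ.*-zeroˡ (B ρ m)))) ⟩
    ∑ typs (λ _ → 0ℚ)
      ≡⟨ ⨁-0 typs ⟩
    0ℚ ∎

theorem35 : (n : ℕ) (σ : Typ n) →
    ( H σ ≈ linearCombination (signedCount σ) E
    × E σ ≈ linearCombination (signedCount σ) H )
    × ( (H-basis : IsBasis n H) (E-basis : IsBasis n E) (τ : Typ n) →
    IsBasis.coefficient E-basis (IsBasis.member H-basis σ) τ ≡ signedCount σ τ
    × IsBasis.coefficient H-basis (IsBasis.member E-basis σ) τ ≡ signedCount σ τ )
theorem35 n σ = (H-in-E , E-in-H) , λ H-basis E-basis τ →
  coefficient-unique E-basis (IsBasis.member H-basis σ) (signedCount σ) H-in-E τ ,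
  coefficient-unique H-basis (IsBasis.member E-basis σ) (signedCount σ) E-in-H τ
  where
  H-in-E : H σ ≈ linearCombination (signedCount σ) E
  -- The left factor of the convolution is the family that records the first brick, here `Edeg`.
  H-in-E = blockProduct-expansion {Hdeg} {Edeg} Hdeg-0 Edeg-0 Edeg∙Hdeg σ
  E-in-H : E σ ≈ linearCombination (signedCount σ) H
  E-in-H = blockProduct-expansion {Edeg} {Hdeg} Edeg-0 Hdeg-0 Hdeg∙Edeg σ
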